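{- The problem Weighted DTW-Mean is solvable with $O(n^{2k+1}2^k k)$ arithmetical operations, where $k$ is the number of input time series and $n$ is the maximum length of any input time series. That is, there is an algorithm which, given univariate rational time series $x^{(1)},\ldots,x^{(k)}$ of maximum length $n$ and rational nonnegative weights $w_1,\ldots,w_k$, outputs, using $O(n^{2k+1}2^kk)$ arithmetical operations, a univariate rational time series $z\in\mathcal{T}$ that minimizes $F_w(z)=\sum_{i=1}^k w_i\,\mathrm{dtw}(z,x^{(i)})^2$ over all of $\mathcal{T}$ (with no restriction on the length of $z$).
   Context: A univariate rational time series of length $n\ge 1$ is a sequence $x=(x_1,\ldots,x_n)\in\mathbb{Q}^n$; $\mathcal{T}_n$ is the set of all those of length $n$, and $\mathcal{T}=\bigcup_{n\in\mathbb{N}}\mathcal{T}_n$. Write $[n]=\{1,\ldots,n\}$. A warping path of order $m\times n$ is a sequence $p=(p_1,\ldots,p_L)$ with $p_\ell\in[m]\times[n]$ such that $p_1=(1,1)$, $p_L=(m,n)$, and $p_{\ell+1}-p_\ell\in\{(1,0),(0,1),(1,1)\}$ for all $\ell\in[L-1]$. The set of all of them is $\mathcal{P}_{m,n}$. For time series $x$ of length $m$ and $y$ of length $n$ and $p=((i_1,j_1),\ldots,(i_L,j_L))\in\mathcal{P}_{m,n}$, the cost is $C_p(x,y)=\sum_{\ell=1}^L(x_{i_\ell}-y_{j_\ell})^2$, and the dtw-distance is $\mathrm{dtw}(x,y)=\min_{p\in\mathcal{P}_{m,n}}\sqrt{C_p(x,y)}$. Weighted DTW-Mean. Input: a sample of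 $k$ univariate rational time series $x^{(1)},\ldots,x^{(k)}$ and rational nonnegative weights $w_1,\ldots,w_k$. Task: find a univariate rational time series $z$ that minimizes the weighted Fréchet function $F_w(z)=\sum_{i=1}^k w_i\,\mathrm{dtw}(z,x^{(i)})^2$. Running time is measured as the number of arithmetical operations (including comparisons and table look-ups) on rational numbers. -}

module Defs where

open import Data.Bool using (if_then_else_)
open import Data.Empty using (⊥-elim)
open import Data.Fin as Fin using (Fin; zero; suc; toℕ; fromℕ; fromℕ<)
import Data.Fin.Properties as Fin
open import Data.List as List using (List; []; _∷_; foldr; map; head; last)
open import Data.List.Relation.Unary.Linked using (Linked; []; [-]; _∷_)
open import Data.Maybe using (just)
open import Data.Nat as ℕ using (ℕ; zero; suc)
import Data.Nat.Properties as ℕ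
open import Data.Nat.Induction using (<-wellFounded)
open import Data.Product using (Σ; ∃; _×_; _,_; proj₁; proj₂)
open import Data.Rational as ℚ using (ℚ; 0ℚ; 1ℚ; ≢-nonZero)
import Data.Rational.Properties as ℚ
open import Data.Sum using (_⊎_; inj₁; inj₂)
open import Data.Vec as Vec using (Vec; lookup)
import Data.Vec.Functional as Vector
open import Algebra.Properties.CommutativeMonoid.Sum ℚ.+-0-commutativeMonoid using (sum)
open import Induction.WellFounded using (Acc; acc)
open import Relation.Binary.PropositionalEquality using (_≡_; refl; sym; trans; cong; subst)
open import Relation.Nullary using (¬_; yes; no; does)

-- The union of all the ℚⁿ with n ≥ 1; the index is n - 1.
𝒯 : Set
𝒯 = ∃ λ l → Vec ℚ (suc l)

len : 𝒯 → ℕ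
len (l , _) = suc l

Point : ℕ → ℕ → Set
Point m n = Fin m × Fin n

data _⇝_ {m n : ℕ} : Point m n → Point m n → Set where
  step₁₀ : ∀ {i i′ j} → toℕ i′ ≡ suc (toℕ i) → (i , j) ⇝ (i′ , j)
  step₀₁ : ∀ {i j j′} → toℕ j′ ≡ suc (toℕ j) → (i , j) ⇝ (i , j′)
  step₁₁ : ∀ {i i′ j j′} → toℕ i′ ≡ suc (toℕ i) → toℕ j′ ≡ suc (toℕ j) →
           (i , j) ⇝ (i′ , j′)

-- Positions are 0-based, so a path of order (m+1) × (n+1) ends in (m , n).
record IsWarpingPath (m n : ℕ) (p : List (Point (suc m) (suc n))) : Set where
  field
    starts : head p ≡ just (zero , zero)
    ends   : last p ≡ just (fromℕ m , fromℕ n)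
    steps  : Linked _⇝_ p

_² : ℚ → ℚ
q ² = q ℚ.* q

cost : ((l , _) (l′ , _) : 𝒯) → List (Point (suc l) (suc l′)) → ℚ
cost (_ , x) (_ , y) p =
  foldr ℚ._+_ 0ℚ (map (λ (i , j) → (lookup x i ℚ.- lookup y j) ²) p)

IsMinimum : {A : Set} → (List A → Set) → (List A → ℚ) → ℚ → Set
IsMinimum P f d = (∃ λ p → P p × f p ≡ d) × (∀ p → P p → d ℚ.≤ f p)

private
  module Existence {m n : ℕ} (f : Point (suc m) (suc n) → ℚ) where

    Pt = Point (suc m) (suc n)

    total : List Pt → ℚ
    total p = foldr ℚ._+_ 0ℚ (map f p)

    end : Pt
    end = fromℕ m , fromℕ n

    From : Pt → List Pt → Set
    From a p = head p ≡ just a × last p ≡ just end × Linked _⇝_ p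

    MinOrEmpty : (List Pt → Set) → Set
    MinOrEmpty P = ∃ (IsMinimum P total) ⊎ (∀ p → ¬ P p)

    _∪_ : (P Q : List Pt → Set) → List Pt → Set
    (P ∪ Q) p = P p ⊎ Q p

    union : ∀ {P Q} → MinOrEmpty P → MinOrEmpty Q → MinOrEmpty (P ∪ Q)
    union (inj₂ noP) (inj₂ noQ) =
      inj₂ λ { p (inj₁ Pp) → noP p Pp ; p (inj₂ Qp) → noQ p Qp }
    union (inj₁ (d , (p , Pp , eq) , d≤)) (inj₂ noQ) =
      inj₁ (d , (p , inj₁ Pp , eq) ,
        λ { q (inj₁ Pq) → d≤ q Pq ; q (inj₂ Qq) → ⊥-elim (noQ q Qq) })
    union (inj₂ noP) (inj₁ (d , (p , Qp , eq) , d≤)) =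
      inj₁ (d , (p , inj₂ Qp , eq) ,
        λ { q (inj₁ Pq) → ⊥-elim (noP q Pq) ; q (inj₂ Qq) → d≤ q Qq })
    union (inj₁ (d , (p , Pp , eq) , d≤)) (inj₁ (e , (r , Qr , eq′) , e≤))
      with ℚ.≤-total d e
    ... | inj₁ d≤e = inj₁ (d , (p , inj₁ Pp , eq) ,
            λ { q (inj₁ Pq) → d≤ q Pq ; q (inj₂ Qq) → ℚ.≤-trans d≤e (e≤ q Qq) })
    ... | inj₂ e≤d = inj₁ (e , (r , inj₂ Qr , eq′) ,
            λ { q (inj₁ Pq) → ℚ.≤-trans e≤d (d≤ q Pq) ; q (inj₂ Qq) → e≤ q Qq })

    transport : ∀ {P Q : List Pt → Set} → (∀ p → P p → Q p) → (∀ p → Q p → P p) →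
                MinOrEmpty P → MinOrEmpty Q
    transport to from (inj₂ noP) = inj₂ λ p Qp → noP p (from p Qp)
    transport to from (inj₁ (d , (p , Pp , eq) , d≤)) =
      inj₁ (d , (p , to p Pp , eq) , λ q Qq → d≤ q (from q Qq))

    Cons : Pt → (List Pt → Set) → List Pt → Set
    Cons a P p = ∃ λ q → p ≡ a ∷ q × P q

    cons : ∀ a {P} → MinOrEmpty P → MinOrEmpty (Cons a P)
    cons a (inj₂ noP) = inj₂ λ { _ (q , _ , Pq) → noP q Pq }
    cons a (inj₁ (d , (p , Pp , refl) , d≤)) =
      inj₁ (f a ℚ.+ d , (a ∷ p , (p , refl , Pp) , refl) ,
        λ { _ (q , refl , Pq) → ℚ.+-monoʳ-≤ (f a) (d≤ q Pq) })

    Stop : Pt → List Pt → Set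
    Stop a p = a ≡ end × p ≡ a ∷ []

    stop : ∀ a → MinOrEmpty (Stop a)
    stop (i , j) with i Fin.≟ fromℕ m | j Fin.≟ fromℕ n
    ... | no i≢  | _      = inj₂ λ { _ (refl , _) → i≢ refl }
    ... | yes _  | no j≢  = inj₂ λ { _ (refl , _) → j≢ refl }
    ... | yes refl | yes refl =
      inj₁ (total (end ∷ []) , (end ∷ [] , (refl , refl) , refl) ,
        λ { _ (_ , refl) → ℚ.≤-refl })

    next : ∀ {k} (i : Fin (suc k)) → (∃ λ i′ → toℕ i′ ≡ suc (toℕ i)) ⊎ i ≡ fromℕ k
    next {k} i with suc (toℕ i) ℕ.<? suc k
    ... | yes i<k = inj₁ (fromℕ< i<k , Fin.toℕ-fromℕ< i<k)
    ... | no  i≮k = inj₂ (Fin.toℕ-injective (trans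
            (ℕ.≤-antisym (Fin.toℕ≤pred[n] i) (ℕ.≤-pred (ℕ.≮⇒≥ i≮k)))
            (sym (Fin.toℕ-fromℕ k))))

    top-blocked : ∀ {k} {i i′ : Fin (suc k)} → i ≡ fromℕ k → ¬ toℕ i′ ≡ suc (toℕ i)
    top-blocked {k} {i′ = i′} refl eq =
      ℕ.<-irrefl (trans eq (cong suc (Fin.toℕ-fromℕ k))) (Fin.toℕ<n i′)

    μ : Pt → ℕ
    μ (i , j) = (suc m ℕ.∸ toℕ i) ℕ.+ (suc n ℕ.∸ toℕ j)

    gap : ∀ {k} {i i′ : Fin k} → toℕ i′ ≡ suc (toℕ i) → k ℕ.∸ toℕ i′ ℕ.< k ℕ.∸ toℕ i
    gap {i = i} {i′} eq =
      ℕ.∸-monoʳ-< (subst (toℕ i ℕ.<_) (sym eq) (ℕ.n<1+n _)) (ℕ.<⇒≤ (Fin.toℕ<n i′))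

    μ-decreases : ∀ {a b} → a ⇝ b → μ b ℕ.< μ a
    μ-decreases {i , j} (step₁₀ e) = ℕ.+-monoˡ-< (suc n ℕ.∸ toℕ j) (gap e)
    μ-decreases {i , j} (step₀₁ e) = ℕ.+-monoʳ-< (suc m ℕ.∸ toℕ i) (gap e)
    μ-decreases         (step₁₁ e e′) = ℕ.+-mono-< (gap e) (gap e′)

    Go₁₀ Go₀₁ Go₁₁ : Pt → List Pt → Set
    Go₁₀ (i , j) q = ∃ λ i′ → toℕ i′ ≡ suc (toℕ i) × From (i′ , j) q
    Go₀₁ (i , j) q = ∃ λ j′ → toℕ j′ ≡ suc (toℕ j) × From (i , j′) q
    Go₁₁ (i , j) q = ∃ λ i′ → ∃ λ j′ →
      toℕ i′ ≡ suc (toℕ i) × toℕ j′ ≡ suc (toℕ j) × From (i′ , j′) q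

    unique : ∀ {k} {i i′ i″ : Fin k} → toℕ i′ ≡ suc (toℕ i) → toℕ i″ ≡ suc (toℕ i) → i″ ≡ i′
    unique e e′ = Fin.toℕ-injective (trans e′ (sym e))

    unfold : ∀ a p → From a p → (Stop a ∪ Cons a (Go₁₀ a ∪ (Go₀₁ a ∪ Go₁₁ a))) p
    unfold a (.a ∷ []) (refl , refl , _) = inj₁ (refl , refl)
    unfold a (.a ∷ b ∷ q) (refl , l , step₁₀ e ∷ s) =
      inj₂ (b ∷ q , refl , inj₁ (_ , e , refl , l , s))
    unfold a (.a ∷ b ∷ q) (refl , l , step₀₁ e ∷ s) =
      inj₂ (b ∷ q , refl , inj₂ (inj₁ (_ , e , refl , l , s)))
    unfold a (.a ∷ b ∷ q) (refl , l , step₁₁ e e′ ∷ s) =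
      inj₂ (b ∷ q , refl , inj₂ (inj₂ (_ , _ , e , e′ , refl , l , s)))

    extend : ∀ {a b q} → a ⇝ b → From b q → From a (a ∷ q)
    extend {q = _ ∷ _} st (refl , l , s) = refl , l , st ∷ s

    refold : ∀ a p → (Stop a ∪ Cons a (Go₁₀ a ∪ (Go₀₁ a ∪ Go₁₁ a))) p → From a p
    refold a _ (inj₁ (refl , refl)) = refl , refl , [-]
    refold a _ (inj₂ (q , refl , inj₁ (_ , e , F))) = extend (step₁₀ e) F
    refold a _ (inj₂ (q , refl , inj₂ (inj₁ (_ , e , F)))) = extend (step₀₁ e) F
    refold a _ (inj₂ (q , refl , inj₂ (inj₂ (_ , _ , e , e′ , F)))) = extend (step₁₁ e e′) F

    search : ∀ a → Acc ℕ._<_ (μ a) → MinOrEmpty (From a)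
    search a@(i , j) (acc rs) =
      transport (refold a) (unfold a) (union (stop a) (cons a (union go₁₀ (union go₀₁ go₁₁))))
      where
      rec : ∀ b → a ⇝ b → MinOrEmpty (From b)
      rec b st = search b (rs (μ-decreases st))

      go₁₀ : MinOrEmpty (Go₁₀ a)
      go₁₀ with next i
      ... | inj₂ top = inj₂ λ { _ (i′ , e , _) → top-blocked {i′ = i′} top e }
      ... | inj₁ (i′ , e) = transport (λ _ F → i′ , e , F)
              (λ { _ (_ , e′ , F) → subst (λ c → From (c , j) _) (sym (unique e′ e)) F })
              (rec (i′ , j) (step₁₀ e))

      go₀₁ : MinOrEmpty (Go₀₁ a)
      go₀₁ with next j
      ... | inj₂ top = inj₂ λ { _ (j′ , e , _) → top-blocked {i′ = j′} top e }
      ... | inj₁ (j′ , e) = transport (λ _ F → j′ , e , F)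
              (λ { _ (_ , e′ , F) → subst (λ c → From (i , c) _) (sym (unique e′ e)) F })
              (rec (i , j′) (step₀₁ e))

      go₁₁ : MinOrEmpty (Go₁₁ a)
      go₁₁ with next i | next j
      ... | inj₂ top | _ = inj₂ λ { _ (i′ , _ , e , _) → top-blocked {i′ = i′} top e }
      ... | inj₁ _ | inj₂ top = inj₂ λ { _ (_ , j′ , _ , e , _) → top-blocked {i′ = j′} top e }
      ... | inj₁ (i′ , e) | inj₁ (j′ , d) = transport (λ _ F → i′ , j′ , e , d , F)
              (λ { _ (_ , _ , e′ , d′ , F) →
                   subst (λ c → From (c , j′) _) (sym (unique e′ e))
                     (subst (λ c → From (_ , c) _) (sym (unique d′ d)) F) })
              (rec (i′ , j′) (step₁₁ e d))

    reach : ∀ a → Acc ℕ._<_ (μ a) → ∃ (From a)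
    reach a@(i , j) (acc rs) with next i | next j
    ... | inj₁ (i′ , e) | _ = _ , extend st (proj₂ (reach (i′ , j) (rs (μ-decreases st))))
      where st = step₁₀ e
    ... | inj₂ _ | inj₁ (j′ , e) = _ , extend st (proj₂ (reach (i , j′) (rs (μ-decreases st))))
      where st = step₀₁ e
    ... | inj₂ refl | inj₂ refl = end ∷ [] , refl , refl , [-]

    minimum : ∃ (IsMinimum (IsWarpingPath m n) total)
    minimum with search (zero , zero) (<-wellFounded _)
    ... | inj₂ none = ⊥-elim (none _ (proj₂ (reach (zero , zero) (<-wellFounded _))))
    ... | inj₁ (d , (p , (h , l , s) , eq) , d≤) =
      d , (p , record { starts = h ; ends = l ; steps = s } , eq) ,
      λ q W → let open IsWarpingPath W in d≤ q (starts , ends , steps)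

minimal-cost : (x@(l , _) y@(l′ , _) : 𝒯) → ∃ (IsMinimum (IsWarpingPath l l′) (cost x y))
minimal-cost (_ , x) (_ , y) =
  Existence.minimum (λ (i , j) → (lookup x i ℚ.- lookup y j) ²)

-- dtw(x,y) is the minimum of √C_p(x,y) over the warping paths p. Since C_p ≥ 0
-- and √ is increasing, its square is the minimum of C_p(x,y), which is rational.
dtw² : 𝒯 → 𝒯 → ℚ
dtw² x y = proj₁ (minimal-cost x y)

dtw²-isMinimum : (x@(l , _) y@(l′ , _) : 𝒯) →
                 IsMinimum (IsWarpingPath l l′) (cost x y) (dtw² x y)
dtw²-isMinimum x y = proj₂ (minimal-cost x y)

Fréchet : ∀ {k} → (Fin k → ℚ) → (Fin k → 𝒯) → 𝒯 → ℚ
Fréchet w x z = sum (λ i → w i ℚ.* dtw² z (x i))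

maxLength : ∀ {k} → (Fin k → 𝒯) → ℕ
maxLength x = Vector.foldr ℕ._⊔_ 0 (λ i → len (x i))

-- A program works on read-only rational inputs, indexed by I, and on a table
-- of rational cells, addressed by ℕ and initially 0. It is a finite tree, that
-- is, the unrolling of a random-access program: addresses and control flow may
-- depend on the shape of the input and on the outcomes of earlier comparisons,
-- but rational values are accessible only through the instructions below.

data Operand (I : Set) : Set where
  input : I → Operand I
  cell  : ℕ → Operand I
  0#    : Operand I
  1#    : Operand I

data Op : Set where
  add sub mul div : Op

data Program (I : Set) : Set where
  assign  : ℕ → Op → Operand I → Operand I → Program I → Program I
  compare : Operand I → Operand I → Program I → Program I → Program I
  output  : ∀ {l} → Vec (Operand I) (suc l) → Program I

-- Division is made total by q / 0 = 0.
_/₀_ : ℚ → ℚ → ℚ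
p /₀ q with q ℚ.≟ 0ℚ
... | yes _  = 0ℚ
... | no q≢0 = ℚ._÷_ p q {{≢-nonZero q≢0}}

⟦_⟧ : Op → ℚ → ℚ → ℚ
⟦ add ⟧ = ℚ._+_
⟦ sub ⟧ = ℚ._-_
⟦ mul ⟧ = ℚ._*_
⟦ div ⟧ = _/₀_

Table : Set
Table = ℕ → ℚ

emptyTable : Table
emptyTable _ = 0ℚ

_[_≔_] : Table → ℕ → ℚ → Table
(σ [ a ≔ q ]) b = if does (a ℕ.≟ b) then q else σ b

module _ {I : Set} (ι : I → ℚ) where

  value : Table → Operand I → ℚ
  value σ (input i) = ι i
  value σ (cell a)  = σ a
  value σ 0#        = 0ℚ
  value σ 1#        = 1ℚ

  result : Program I → Table → 𝒯
  result (assign a o u v p) σ = result p (σ [ a ≔ ⟦ o ⟧ (value σ u) (value σ v) ])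
  result (compare u v p q)  σ =
    if does (value σ u ℚ.≤? value σ v) then result p σ else result q σ
  result (output us)        σ = _ , Vec.map (value σ) us

  -- An assignment is charged for two look-ups, one operation and one store; a
  -- comparison for two look-ups and the comparison; an output for its look-ups.
  operations : Program I → Table → ℕ
  operations (assign a o u v p) σ =
    4 ℕ.+ operations p (σ [ a ≔ ⟦ o ⟧ (value σ u) (value σ v) ])
  operations (compare u v p q)  σ =
    3 ℕ.+ (if does (value σ u ℚ.≤? value σ v) then operations p σ else operations q σ)
  operations (output {l} us)    σ = suc l

-- Input positions for k time series, the i-th of length suc (l i).
data InputPos {k : ℕ} (l : Fin k → ℕ) : Set where
  entry  : (i : Fin k) → Fin (suc (l i)) → InputPos l
  weight : Fin k → InputPos l

inputs : ∀ {k} (w : Fin k → ℚ) (x : Fin k → 𝒯) → InputPos (λ i → proj₁ (x i)) → ℚ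
inputs w x (entry i j) = lookup (proj₂ (x i)) j
inputs w x (weight i)  = w i

-- The program depends on the number and the lengths of the input time series
-- only, and does so computably, being given by a function.
Algorithm : Set
Algorithm = ∀ {k} (l : Fin k → ℕ) → Program (InputPos l)

solution : Algorithm → ∀ {k} → (Fin k → ℚ) → (Fin k → 𝒯) → 𝒯
solution A w x = result (inputs w x) (A _) emptyTable

runningTime : Algorithm → ∀ {k} → (Fin k → ℚ) → (Fin k → 𝒯) → ℕ
runningTime A w x = operations (inputs w x) (A _) emptyTable

{-# OPTIONS --safe #-}
module Submission where

-- Reading a warping path between z and a time series row by row, every element
-- of z is matched with a block of consecutive entries, and the next element of
-- z starts in the last entry of that block or in the entry after it. For k
-- series simultaneously, the entries at which the rows start form a state in
-- a grid with at most n^k points. An element of z that leaves the state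
-- unchanged can be deleted without increasing the cost, so an optimal z runs
-- through strictly decreasing states, and its value at each of them may be taken
-- to be the weighted mean of the k matched blocks. Dynamic programming over the
-- states compares at most (2n)^k transitions in each of them, at a price of
-- O(kn) operations for the mean and the cost of one transition. Which
-- transition is best is decided by the control flow of the program, so that
-- tables contain rational values only and backtracking is free.

open import Defs
open import Data.Nat using (ℕ; NonZero; _+_; _*_; _^_; _≤_)
open import Data.Fin using (Fin)
open import Data.Product using (∃; _×_)
import Data.Rational as ℚ

open import Data.Bool using (if_then_else_)
open import Data.Fin using (zero; suc; toℕ; fromℕ; fromℕ<)
import Data.Fin.Properties as Fin
open import Data.List using (List; []; _∷_; _++_; cartesianProductWith; downFrom; drop; foldr; last; length; map; upTo)
import Data.List.Properties as List
open import Data.List.Membership.Propositional using (_∈_)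
open import Data.List.Membership.Propositional.Properties using (∈-cartesianProductWith⁺; ∈-cartesianProductWith⁻;
  ∈-map⁺; ∈-map⁻; ∈-upTo⁺; ∈-upTo⁻)
open import Data.List.Relation.Unary.All as All using (All; []; _∷_)
import Data.List.Relation.Unary.All.Properties as All
open import Data.List.Relation.Unary.AllPairs as AllPairs using (AllPairs; []; _∷_)
import Data.List.Relation.Unary.AllPairs.Properties as AllPairs
open import Data.List.Relation.Unary.Any using (here; there)
open import Data.List.Relation.Unary.Linked using (Linked; []; [-]; _∷_)
open import Data.Maybe using (just)
open import Data.Nat as ℕ using (zero; suc; _∸_; _<_; z≤n; s≤s)
import Data.Nat.Properties as ℕ
import Data.Nat.Solver as ℕ-Solver
open import Data.Product using (∃₂; _,_; proj₁; proj₂)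
open ℚ using (ℚ; 0ℚ; 1ℚ)
import Data.Rational.Properties as ℚ
import Data.Rational.Solver as ℚ-Solver
open import Data.Sum using (_⊎_; inj₁; inj₂)
open import Data.Unit using (⊤; tt)
open import Data.Vec as Vec using (Vec; []; _∷_; lookup; tabulate; toList)
import Data.Vec.Properties as Vec
open import Data.Vec.Relation.Binary.Pointwise.Inductive as Pointwise using (Pointwise; []; _∷_)
open import Function using (_∘_; case_of_)
open import Relation.Binary.PropositionalEquality using (_≡_; _≢_; refl; sym; trans; cong; cong₂; subst; subst₂;
  module ≡-Reasoning)
open import Relation.Nullary using (Dec; ¬_; does; yes; no; contradiction)
open import Relation.Nullary.Decidable using (dec-true; dec-false)
open import Algebra.Properties.CommutativeMonoid.Sum ℚ.+-0-commutativeMonoid using (sum; sum-cong-≗; ∑-distrib-+)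
open import Algebra.Properties.CommutativeSemigroup ℕ.*-commutativeSemigroup
  using () renaming (interchange to *-interchange)

-- Sums and signs of rationals

Σℚ : List ℚ → ℚ
Σℚ = foldr ℚ._+_ 0ℚ

0≤p+q : ∀ {p q} → 0ℚ ℚ.≤ p → 0ℚ ℚ.≤ q → 0ℚ ℚ.≤ p ℚ.+ q
0≤p+q = ℚ.+-mono-≤ {0ℚ} {_} {0ℚ}

0≤p*q : ∀ {p q} → 0ℚ ℚ.≤ p → 0ℚ ℚ.≤ q → 0ℚ ℚ.≤ p ℚ.* q
0≤p*q {p} {q} 0≤p 0≤q = ℚ.nonNegative⁻¹ _
  {{ℚ.nonNeg*nonNeg⇒nonNeg p {{ℚ.nonNegative 0≤p}} q {{ℚ.nonNegative 0≤q}}}}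

0≤q² : ∀ q → 0ℚ ℚ.≤ q ²
0≤q² q with ℚ.≤-total 0ℚ q
... | inj₁ 0≤q = 0≤p*q 0≤q 0≤q
... | inj₂ q≤0 = subst (0ℚ ℚ.≤_) (solve 1 (λ q → (:- q) :* (:- q) := q :* q) refl q)
                   (0≤p*q (ℚ.neg-antimono-≤ q≤0) (ℚ.neg-antimono-≤ q≤0))
  where open ℚ-Solver.+-*-Solver

p≤p+q : ∀ p {q} → 0ℚ ℚ.≤ q → p ℚ.≤ p ℚ.+ q
p≤p+q p 0≤q = ℚ.≤-trans (ℚ.≤-reflexive (sym (ℚ.+-identityʳ p))) (ℚ.+-monoʳ-≤ p 0≤q)

q≤p+q : ∀ q {p} → 0ℚ ℚ.≤ p → q ℚ.≤ p ℚ.+ q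
q≤p+q q 0≤p = ℚ.≤-trans (p≤p+q q 0≤p) (ℚ.≤-reflexive (ℚ.+-comm q _))

p+q≡0⇒p≡0 : ∀ {p q} → 0ℚ ℚ.≤ p → 0ℚ ℚ.≤ q → p ℚ.+ q ≡ 0ℚ → p ≡ 0ℚ
p+q≡0⇒p≡0 0≤p 0≤q eq =
  ℚ.≤-antisym (ℚ.≤-trans (p≤p+q _ 0≤q) (ℚ.≤-reflexive eq)) 0≤p

-- Optimality of the weighted mean

module WeightedMean {I : Set} (ι : I → ℚ) where

  Weighted : I × I → Set
  Weighted (w , _) = 0ℚ ℚ.≤ ι w

  mass moment : List (I × I) → ℚ
  mass   ps = Σℚ (map (λ (w , _) → ι w) ps)
  moment ps = Σℚ (map (λ (w , x) → ι w ℚ.* ι x) ps)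

  spread : ℚ → List (I × I) → ℚ
  spread z ps = Σℚ (map (λ (w , x) → ι w ℚ.* (z ℚ.- ι x) ²) ps)

  mean : List (I × I) → ℚ
  mean ps = moment ps /₀ mass ps

  0≤mass : ∀ {ps} → All Weighted ps → 0ℚ ℚ.≤ mass ps
  0≤mass []           = ℚ.≤-refl
  0≤mass (0≤w ∷ 0≤ws) = 0≤p+q 0≤w (0≤mass 0≤ws)

  mass≡0⇒moment≡0 : ∀ {ps} → All Weighted ps → mass ps ≡ 0ℚ → moment ps ≡ 0ℚ
  mass≡0⇒moment≡0 [] _ = refl
  mass≡0⇒moment≡0 {(w , x) ∷ ps} (0≤w ∷ 0≤ws) eq = cong₂ ℚ._+_
    (trans (cong (ℚ._* ι x) (p+q≡0⇒p≡0 0≤w (0≤mass 0≤ws) eq)) (ℚ.*-zeroˡ (ι x)))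
    (mass≡0⇒moment≡0 0≤ws
      (p+q≡0⇒p≡0 (0≤mass 0≤ws) 0≤w (trans (ℚ.+-comm (mass ps) (ι w)) eq)))

  -- If the mass vanishes, so does the moment, and the value 0 / 0 = 0 does no harm.
  mass*mean : ∀ {ps} → All Weighted ps → mass ps ℚ.* mean ps ≡ moment ps
  mass*mean {ps} 0≤ws with mass ps ℚ.≟ 0ℚ
  ... | yes W≡0 = trans (ℚ.*-zeroʳ (mass ps)) (sym (mass≡0⇒moment≡0 0≤ws W≡0))
  ... | no  W≢0 = begin
      W ℚ.* (S ℚ.* V) ≡⟨ solve 3 (λ W S V → W :* (S :* V) := S :* (W :* V)) refl W S V ⟩
      S ℚ.* (W ℚ.* V) ≡⟨ cong (S ℚ.*_) (ℚ.*-inverseʳ W) ⟩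
      S ℚ.* 1ℚ        ≡⟨ ℚ.*-identityʳ S ⟩
      S               ∎
    where
    open ≡-Reasoning
    open ℚ-Solver.+-*-Solver
    instance _ = ℚ.≢-nonZero W≢0
    W = mass ps
    S = moment ps
    V = ℚ.1/ W

  -- In `z` this is a quadratic polynomial with leading coefficient `mass ps` and linear coefficient
  -- -2 `moment ps`, so the difference of its values at `z` and `m` has the factor `z - m`. The
  -- identity is free of division and thus covers vanishing mass.
  spread-shift : ∀ z m ps → spread z ps ≡
    spread m ps ℚ.+ (z ℚ.- m) ℚ.* ((z ℚ.+ m) ℚ.* mass ps ℚ.- (moment ps ℚ.+ moment ps))
  spread-shift z m [] =
    solve 2 (λ z m → con 0ℚ := con 0ℚ :+ (z :- m) :* ((z :+ m) :* con 0ℚ :- (con 0ℚ :+ con 0ℚ)))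
      refl z m
    where open ℚ-Solver.+-*-Solver
  spread-shift z m ((w , x) ∷ ps) = trans
    (cong (ι w ℚ.* (z ℚ.- ι x) ² ℚ.+_) (spread-shift z m ps))
    (solve 7 (λ z m w x W S D →
        w :* ((z :- x) :* (z :- x)) :+ (D :+ (z :- m) :* ((z :+ m) :* W :- (S :+ S)))
        := (w :* ((m :- x) :* (m :- x)) :+ D) :+
           (z :- m) :* ((z :+ m) :* (w :+ W) :- ((w :* x :+ S) :+ (w :* x :+ S))))
      refl z m (ι w) (ι x) (mass ps) (moment ps) (spread m ps))
    where open ℚ-Solver.+-*-Solver

  -- Since `mass ps` times the mean is `moment ps`, the correction term of `spread-shift` at the
  -- mean `m` becomes the mass times (z - m)², which is nonnegative.
  mean-optimal : ∀ {ps} → All Weighted ps → ∀ z → spread (mean ps) ps ℚ.≤ spread z ps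
  mean-optimal {ps} 0≤ws z = begin
    spread m ps                                      ≤⟨ p≤p+q _ (0≤p*q (0≤mass 0≤ws) (0≤q² (z ℚ.- m))) ⟩
    spread m ps ℚ.+ W ℚ.* (z ℚ.- m) ²                ≡⟨ cong (spread m ps ℚ.+_)
      (solve 3 (λ z m W → W :* ((z :- m) :* (z :- m)) :=
        (z :- m) :* ((z :+ m) :* W :- (W :* m :+ W :* m))) refl z m W) ⟩
    spread m ps ℚ.+ (z ℚ.- m) ℚ.* ((z ℚ.+ m) ℚ.* W ℚ.- (W ℚ.* m ℚ.+ W ℚ.* m))
      ≡⟨ cong (λ S → spread m ps ℚ.+ (z ℚ.- m) ℚ.* ((z ℚ.+ m) ℚ.* W ℚ.- (S ℚ.+ S))) (mass*mean 0≤ws) ⟩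
    spread m ps ℚ.+ (z ℚ.- m) ℚ.* ((z ℚ.+ m) ℚ.* W ℚ.- (moment ps ℚ.+ moment ps))
      ≡⟨ spread-shift z m ps ⟨
    spread z ps ∎
    where
    open ℚ.≤-Reasoning
    open ℚ-Solver.+-*-Solver
    m = mean ps
    W = mass ps

-- Programs

-- Arithmetic without control flow. Every inner node becomes one assignment to a fresh cell and
-- leaves produce no instruction; hence `size` ignores leaves.
data Expr (I : Set) : Set where
  leaf : Operand I → Expr I
  node : Op → Expr I → Expr I → Expr I

module _ {I : Set} where

  size : Expr I → ℕ
  size (leaf _)     = 0
  size (node _ e f) = suc (size e + size f)

  Σᴱ : List (Expr I) → Expr I
  Σᴱ = foldr (node add) (leaf 0#)

  meanᴱ : List (I × I) → Expr I
  meanᴱ ps = node div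
    (Σᴱ (map (λ (w , x) → node mul (leaf (input w)) (leaf (input x))) ps))
    (Σᴱ (map (λ (w , _) → leaf (input w)) ps))

  -- `u` is an operand, so the mean is computed once and then looked up. The square repeats the
  -- subtraction, which makes 4 nodes per sample and a fifth for the sum.
  spreadᴱ : Operand I → List (I × I) → Expr I
  spreadᴱ u ps = Σᴱ (map (λ (w , x) → node mul (leaf (input w))
    (node mul (node sub (leaf u) (leaf (input x))) (node sub (leaf u) (leaf (input x))))) ps)

  size-Σᴱ : ∀ {A : Set} {f : A → Expr I} c → (∀ a → size (f a) ≡ c) →
            ∀ as → size (Σᴱ (map f as)) ≡ length as * suc c
  size-Σᴱ c eq []       = refl
  size-Σᴱ c eq (a ∷ as) = cong suc (cong₂ _+_ (eq a) (size-Σᴱ c eq as))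

  -- The first argument of a continuation is the least address not used so far.
  compile : Expr I → ℕ → (ℕ → Operand I → Program I) → Program I
  compile (leaf u)     n κ = κ n u
  compile (node o e f) n κ =
    compile e n λ n u → compile f n λ n v → assign n o u v (κ (suc n) (cell n))

  extend : List (I × I) → Operand I → ℕ →
           (ℕ → Operand I → Operand I → Program I) → Program I
  extend ps b n κ =
    compile (meanᴱ ps) n λ n u →
    compile (node add (spreadᴱ u ps) (leaf b)) n λ n v → κ n u v

-- A table in which exactly the cells below a given address may be in use.
World : Set
World = ℕ × Table

-- Compiled code never overwrites a cell in use. Operands remembered by the control flow therefore
-- keep their values, and evaluation is monotone along this order.
_⊑_ : World → World → Set
(n , σ) ⊑ (n′ , σ′) = n ≤ n′ × (∀ a → a < n → σ′ a ≡ σ a)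

⊑-refl : ∀ {W} → W ⊑ W
⊑-refl = ℕ.≤-refl , λ _ _ → refl

⊑-trans : ∀ {U V W} → U ⊑ V → V ⊑ W → U ⊑ W
⊑-trans (l , e) (l′ , e′) = ℕ.≤-trans l l′ , λ a a< → trans (e′ a (ℕ.<-≤-trans a< l)) (e a a<)

store : World → ℚ → World
store (n , σ) q = suc n , σ [ n ≔ q ]

store-⊑ : ∀ {W q} → W ⊑ store W q
store-⊑ {n , σ} {q} = ℕ.n≤1+n n , other
  where
  other : ∀ a → a < n → (σ [ n ≔ q ]) a ≡ σ a
  other a a<n = cong (if_then q else σ a) (dec-false (n ℕ.≟ a) (ℕ.<⇒≢ a<n ∘ sym))

store-same : ∀ σ n q → (σ [ n ≔ q ]) n ≡ q
store-same σ n q = cong (if_then q else σ n) (dec-true (n ℕ.≟ n) refl)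

-- Evaluation and cost of compiled code

module Machine {I : Set} (ι : I → ℚ) where
  open WeightedMean ι

  Below : ℕ → Operand I → Set
  Below n (cell a) = a < n
  Below n _        = ⊤

  infix 4 _⊢_⇓_ _⊢ᴱ_⇓_ _⊢*_⇓_

  _⊢_⇓_ : World → Operand I → ℚ → Set
  (n , σ) ⊢ u ⇓ q = Below n u × value ι σ u ≡ q

  data _⊢ᴱ_⇓_ (W : World) : Expr I → ℚ → Set where
    leaf : ∀ {u q} → W ⊢ u ⇓ q → W ⊢ᴱ leaf u ⇓ q
    node : ∀ {o e f p q} → W ⊢ᴱ e ⇓ p → W ⊢ᴱ f ⇓ q → W ⊢ᴱ node o e f ⇓ ⟦ o ⟧ p q

  _⊢*_⇓_ : World → ∀ {n} → Vec (Operand I) n → Vec ℚ n → Set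
  W ⊢* us ⇓ qs = Pointwise (W ⊢_⇓_) us qs

  ⇓-mono : ∀ {W W′ u q} → W ⊑ W′ → W ⊢ u ⇓ q → W′ ⊢ u ⇓ q
  ⇓-mono {u = input _} _       v       = v
  ⇓-mono {u = cell a}  (l , e) (b , v) = ℕ.<-≤-trans b l , trans (e a b) v
  ⇓-mono {u = 0#}      _       v       = v
  ⇓-mono {u = 1#}      _       v       = v

  ⇓ᴱ-mono : ∀ {W W′ e q} → W ⊑ W′ → W ⊢ᴱ e ⇓ q → W′ ⊢ᴱ e ⇓ q
  ⇓ᴱ-mono W⊑ (leaf d)   = leaf (⇓-mono W⊑ d)
  ⇓ᴱ-mono W⊑ (node d c) = node (⇓ᴱ-mono W⊑ d) (⇓ᴱ-mono W⊑ c)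

  ⇓*-mono : ∀ {W W′ n} {us : Vec _ n} {qs} → W ⊑ W′ → W ⊢* us ⇓ qs → W′ ⊢* us ⇓ qs
  ⇓*-mono W⊑ = Pointwise.map (⇓-mono W⊑)

  ⇓*⇒≡ : ∀ {n σ m} {us : Vec _ m} {qs} → (n , σ) ⊢* us ⇓ qs → Vec.map (value ι σ) us ≡ qs
  ⇓*⇒≡ []             = refl
  ⇓*⇒≡ ((_ , eq) ∷ p) = cong₂ _∷_ eq (⇓*⇒≡ p)

  input⇓ : ∀ {W} i → W ⊢ᴱ leaf (input i) ⇓ ι i
  input⇓ i = leaf (tt , refl)

  Σᴱ⇓ : ∀ {W} {A : Set} {f : A → Expr I} {g} → (∀ a → W ⊢ᴱ f a ⇓ g a) →
        ∀ as → W ⊢ᴱ Σᴱ (map f as) ⇓ Σℚ (map g as)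
  Σᴱ⇓ d []       = leaf (tt , refl)
  Σᴱ⇓ d (a ∷ as) = node (d a) (Σᴱ⇓ d as)

  meanᴱ⇓ : ∀ {W} ps → W ⊢ᴱ meanᴱ ps ⇓ mean ps
  meanᴱ⇓ ps = node (Σᴱ⇓ (λ (w , x) → node (input⇓ w) (input⇓ x)) ps)
                   (Σᴱ⇓ (λ (w , _) → input⇓ w) ps)

  spreadᴱ⇓ : ∀ {W u z} → W ⊢ u ⇓ z → ∀ ps → W ⊢ᴱ spreadᴱ u ps ⇓ spread z ps
  spreadᴱ⇓ d = Σᴱ⇓ λ (w , x) → node (input⇓ w)
    (node (node (leaf d) (input⇓ x)) (node (leaf d) (input⇓ x)))

  module _ (R : 𝒯 → Set) where

    -- Correctness and cost travel together. As programs are built from continuations, each rule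
    -- below turns outcomes of the continuation in all later worlds into an outcome of the whole.
    record Outcome (p : Program I) (σ : Table) (b : ℕ) : Set where
      constructor _,_
      field
        holds   : R (result ι p σ)
        bounded : operations ι p σ ≤ b

    Outcome-≤ : ∀ {p σ b b′} → b ≤ b′ → Outcome p σ b → Outcome p σ b′
    Outcome-≤ b≤b′ (r , ≤b) = r , ℕ.≤-trans ≤b b≤b′

    -- The decision is a variable here, so one case split reduces the conditionals of `result` and
    -- `operations` simultaneously.
    branch : ∀ {P : Set} {p q σ b} (P? : Dec P) →
      (P → Outcome p σ b) → (¬ P → Outcome q σ b) →
      R (if does P? then result ι p σ else result ι q σ) ×
      3 + (if does P? then operations ι p σ else operations ι q σ) ≤ 3 + b
    branch (yes p) yes≤ _   with r , ≤b ← yes≤ p = r , ℕ.+-monoʳ-≤ 3 ≤b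
    branch (no ¬p) _    no≤ with r , ≤b ← no≤ ¬p = r , ℕ.+-monoʳ-≤ 3 ≤b

    compare-outcome : ∀ {W u v p q d e b} → W ⊢ u ⇓ d → W ⊢ v ⇓ e →
      (d ℚ.≤ e → Outcome p (proj₂ W) b) → (e ℚ.≤ d → Outcome q (proj₂ W) b) →
      Outcome (compare u v p q) (proj₂ W) (3 + b)
    compare-outcome {_ , σ} {u} {v} (_ , refl) (_ , refl) yes≤ no≤ =
      let r , ≤b = branch (value ι σ u ℚ.≤? value ι σ v) yes≤ (no≤ ∘ ℚ.<⇒≤ ∘ ℚ.≰⇒>)
      in r , ≤b

    -- The value of the first subexpression survives the code of the second, which stores into fresh
    -- cells only; the assignment at the node accounts for 4 operations.
    compile-outcome : ∀ e {W q κ b} → W ⊢ᴱ e ⇓ q →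
      (∀ {W′ u} → W ⊑ W′ → W′ ⊢ u ⇓ q → Outcome (κ (proj₁ W′) u) (proj₂ W′) b) →
      Outcome (compile e (proj₁ W) κ) (proj₂ W) (4 * size e + b)
    compile-outcome (leaf u) (leaf d) K = K ⊑-refl d
    compile-outcome (node o e f) {κ = κ} {b} (node d c) K =
      Outcome-≤ (ℕ.≤-reflexive count)
        (compile-outcome e d λ W⊑₁ d₁ → compile-outcome f (⇓ᴱ-mono W⊑₁ c)
          λ { {n , σ} W⊑₂ (_ , refl) → case (⇓-mono W⊑₂ d₁) of λ { (_ , refl) →
            charge (K (⊑-trans W⊑₁ (⊑-trans W⊑₂ store-⊑)) (ℕ.n<1+n _ , store-same σ n _)) } })
      where
      charge : ∀ {n u v σ} → Outcome (κ (suc n) (cell n)) (σ [ n ≔ ⟦ o ⟧ (value ι σ u) (value ι σ v) ]) b →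
               Outcome (assign n o u v (κ (suc n) (cell n))) σ (4 + b)
      charge (r , ≤b) = r , ℕ.+-monoʳ-≤ 4 ≤b
      open ℕ-Solver.+-*-Solver
      count : 4 * size e + (4 * size f + (4 + b)) ≡ 4 * size (node o e f) + b
      count = solve 3 (λ s t b → con 4 :* s :+ (con 4 :* t :+ (con 4 :+ b))
                := con 4 :* (con 1 :+ (s :+ t)) :+ b) refl (size e) (size f) b

    -- Each node costs 4 operations; with p samples there are 3 p + 1 nodes for the
    -- mean and 5 p + 1 for the value.
    extend-outcome : ∀ ps {W u d κ b} → W ⊢ u ⇓ d →
      (∀ {W′ m v} → W ⊑ W′ → W′ ⊢ m ⇓ mean ps → W′ ⊢ v ⇓ spread (mean ps) ps ℚ.+ d →
         Outcome (κ (proj₁ W′) m v) (proj₂ W′) b) →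
      Outcome (extend ps u (proj₁ W) κ) (proj₂ W) (32 * length ps + 8 + b)
    extend-outcome ps {u = u} {b = b} D K =
      Outcome-≤ (ℕ.≤-reflexive count)
        (compile-outcome (meanᴱ ps) (meanᴱ⇓ ps) λ {_} {m} W⊑₁ M →
         Outcome-≤ (ℕ.≤-reflexive (cong (λ s → 4 * suc (s + 0) + b) (size-Σᴱ 4 (λ _ → refl) ps)))
         (compile-outcome (node add (spreadᴱ m ps) (leaf u))
           (node (spreadᴱ⇓ M ps) (leaf (⇓-mono W⊑₁ D))) λ W⊑₂ V →
         K (⊑-trans W⊑₁ W⊑₂) (⇓-mono W⊑₂ M) V))
      where
      open ℕ-Solver.+-*-Solver
      count : 4 * size (meanᴱ ps) + (4 * suc (length ps * 5 + 0) + b) ≡ 32 * length ps + 8 + b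
      count rewrite size-Σᴱ {f = λ (w , x) → node mul (leaf (input w)) (leaf (input x))} 1 (λ _ → refl) ps
        | size-Σᴱ {f = λ (w , _) → leaf (input w)} 0 (λ _ → refl) ps
        = solve 2 (λ l b → con 4 :* (con 1 :+ (l :* con 2 :+ l :* con 1)) :+
                     (con 4 :* (con 1 :+ (l :* con 5 :+ con 0)) :+ b)
                   := con 32 :* l :+ con 8 :+ b) refl (length ps) b

-- Walks and blocks

-- A time series y is indexed by the number of its elements that are still to
-- come; Walk y zs m c is a warping path of cost c between zs and y m, …, y 0.
data Walk (y : ℕ → ℚ) : List ℚ → ℕ → ℚ → Set where
  stop   : ∀ {z} → Walk y (z ∷ []) 0 ((z ℚ.- y 0) ² ℚ.+ 0ℚ)
  walk₁₀ : ∀ {z zs m c} → Walk y zs m c → Walk y (z ∷ zs) m ((z ℚ.- y m) ² ℚ.+ c)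
  walk₀₁ : ∀ {z zs m c} → Walk y (z ∷ zs) m c →
           Walk y (z ∷ zs) (suc m) ((z ℚ.- y (suc m)) ² ℚ.+ c)
  walk₁₁ : ∀ {z zs m c} → Walk y zs m c → Walk y (z ∷ zs) (suc m) ((z ℚ.- y (suc m)) ² ℚ.+ c)

-- The block of indices aligned with one element of the mean, and the index at
-- which the next element of the mean starts.
Move : Set
Move = List ℕ × ℕ

-- From a successor, the first two moves close the block after one entry, and the next element
-- starts in that entry or in the one after it; the others lengthen the block. At 0 no entry
-- follows, so there are 2 m + 1 moves from m.
moves : ℕ → List Move
moves zero    = (0 ∷ [] , 0) ∷ []
moves (suc m) = (suc m ∷ [] , suc m) ∷ (suc m ∷ [] , m) ∷ map (λ (B , t) → suc m ∷ B , t) (moves m)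

length-moves : ∀ m → length (moves m) ≤ 2 * suc m
length-moves zero    = s≤s z≤n
length-moves (suc m) = begin
  2 + length (map _ (moves m)) ≡⟨ cong (2 +_) (List.length-map _ (moves m)) ⟩
  2 + length (moves m)         ≤⟨ ℕ.+-monoʳ-≤ 2 (length-moves m) ⟩
  2 + 2 * suc m                ≡⟨ ℕ.*-suc 2 (suc m) ⟨
  2 * suc (suc m)              ∎
  where open ℕ.≤-Reasoning

moves-bounds : ∀ m {B t} → (B , t) ∈ moves m → length B ≤ suc m × t ≤ m
moves-bounds zero    (here refl)         = s≤s z≤n , z≤n
moves-bounds (suc m) (here refl)         = s≤s z≤n , ℕ.≤-refl
moves-bounds (suc m) (there (here refl)) = s≤s z≤n , ℕ.n≤1+n m
moves-bounds (suc m) (there (there e∈)) with _ , e∈ , refl ← ∈-map⁻ _ e∈ =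
  let B≤ , t≤ = moves-bounds m e∈ in s≤s B≤ , ℕ.m≤n⇒m≤1+n t≤

blockCost : (ℕ → ℚ) → ℚ → List ℕ → ℚ
blockCost y z B = Σℚ (map (λ b → (z ℚ.- y b) ²) B)

module _ {y : ℕ → ℚ} where

  walk-last⁺ : ∀ {z} m → Walk y (z ∷ []) m (blockCost y z (downFrom (suc m)))
  walk-last⁺ zero    = stop
  walk-last⁺ (suc m) = walk₀₁ (walk-last⁺ m)

  walk-last⁻ : ∀ {z m c} → Walk y (z ∷ []) m c → c ≡ blockCost y z (downFrom (suc m))
  walk-last⁻ stop = refl
  walk-last⁻ {z} {suc m} (walk₀₁ p) = cong ((z ℚ.- y (suc m)) ² ℚ.+_) (walk-last⁻ p)

  -- The entries of the block are visited by `walk₀₁`; its last one is left by `walk₁₀` or `walk₁₁`,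
  -- according to where the next element starts.
  walk-cons⁺ : ∀ {z zs c} m {B t} → (B , t) ∈ moves m → Walk y zs t c →
               Walk y (z ∷ zs) m (blockCost y z B ℚ.+ c)
  walk-cons⁺ {z} {c = c} m B∈ p = go m B∈ p
    where
    single : ∀ {t b} → Walk y t b ((z ℚ.- y b) ² ℚ.+ c) → Walk y t b ((z ℚ.- y b) ² ℚ.+ 0ℚ ℚ.+ c)
    single {b = b} = subst (Walk y _ _) (cong (ℚ._+ c) (sym (ℚ.+-identityʳ ((z ℚ.- y b) ²))))

    go : ∀ {zs} m {B t} → (B , t) ∈ moves m → Walk y zs t c →
         Walk y (z ∷ zs) m (blockCost y z B ℚ.+ c)
    go zero    (here refl)         p = single (walk₁₀ p)
    go (suc m) (here refl)         p = single (walk₁₀ p)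
    go (suc m) (there (here refl)) p = single (walk₁₁ p)
    go (suc m) (there (there B∈))  p with (B , _) , B∈ , refl ← ∈-map⁻ _ B∈ =
      subst (Walk y _ _) (sym (ℚ.+-assoc ((z ℚ.- y (suc m)) ²) (blockCost y z B) c)) (walk₀₁ (go m B∈ p))

  record Split (z : ℚ) (zs : List ℚ) (m : ℕ) (c : ℚ) : Set where
    constructor split
    field
      {move}   : Move
      {rest}   : ℚ
      possible : move ∈ moves m
      onward   : Walk y zs (proj₂ move) rest
      costs    : c ≡ blockCost y z (proj₁ move) ℚ.+ rest

  -- A second element follows, so the walk cannot stop in the first row: it leaves it by `walk₁₀` or
  -- `walk₁₁`, and the entries met until then are the block.
  walk-cons⁻ : ∀ {z z′ zs m c} → Walk y (z ∷ z′ ∷ zs) m c → Split z (z′ ∷ zs) m c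
  walk-cons⁻ {z} = go
    where
    single : ∀ {b c} → (z ℚ.- y b) ² ℚ.+ c ≡ (z ℚ.- y b) ² ℚ.+ 0ℚ ℚ.+ c
    single {b} {c} = cong (ℚ._+ c) (sym (ℚ.+-identityʳ ((z ℚ.- y b) ²)))

    go : ∀ {z′ zs m c} → Walk y (z ∷ z′ ∷ zs) m c → Split z (z′ ∷ zs) m c
    go (walk₁₀ {m = zero} p)  = split (here refl) p (single {0})
    go (walk₁₀ {m = suc m} p) = split (here refl) p (single {suc m})
    go (walk₁₁ {m = m} p)     = split (there (here refl)) p (single {suc m})
    go (walk₀₁ {m = m} p) with split {B , _} {c} B∈ q eq ← go p =
      split (there (there (∈-map⁺ _ B∈))) q
        (trans (cong ((z ℚ.- y (suc m)) ² ℚ.+_) eq) (sym (ℚ.+-assoc ((z ℚ.- y (suc m)) ²) (blockCost y z B) c)))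

-- Simultaneous choices and the componentwise order

module _ {A B : Set} (f : B → List A) where

  choices : ∀ {k} → Vec B k → List (Vec A k)
  choices []       = [] ∷ []
  choices (b ∷ bs) = cartesianProductWith _∷_ (f b) (choices bs)

  ∈-choices⁺ : ∀ {k} (as : Vec A k) bs → (∀ j → lookup as j ∈ f (lookup bs j)) → as ∈ choices bs
  ∈-choices⁺ []       []       _  = here refl
  ∈-choices⁺ (a ∷ as) (b ∷ bs) p = ∈-cartesianProductWith⁺ _∷_ (p zero) (∈-choices⁺ as bs (p ∘ suc))

  ∈-choices⁻ : ∀ {k} {as : Vec A k} bs → as ∈ choices bs → ∀ j → lookup as j ∈ f (lookup bs j)
  ∈-choices⁻ (b ∷ bs) as∈ j with ∈-cartesianProductWith⁻ _∷_ (f b) (choices bs) as∈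
  ∈-choices⁻ (b ∷ bs) _ zero    | _ , _ , a∈ , _ , refl = a∈
  ∈-choices⁻ (b ∷ bs) _ (suc j) | _ , _ , _ , as∈ , refl = ∈-choices⁻ bs as∈ j

  length-choices : ∀ {k n} (bs : Vec B k) → (∀ j → length (f (lookup bs j)) ≤ n) →
                   length (choices bs) ≤ n ^ k
  length-choices []       _  = ℕ.≤-refl
  length-choices {suc k} {n} (b ∷ bs) p = begin
    length (choices (b ∷ bs))             ≡⟨ length-product (f b) ⟩
    length (f b) * length (choices bs)    ≤⟨ ℕ.*-mono-≤ (p zero) (length-choices bs (p ∘ suc)) ⟩
    n * n ^ k                             ∎
    where
    open ℕ.≤-Reasoning
    length-product : ∀ as → length (cartesianProductWith Vec._∷_ as (choices bs)) ≡
                            length as * length (choices bs)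
    length-product []       = refl
    length-product (a ∷ as) = trans (List.length-++ (map (a ∷_) (choices bs)))
      (cong₂ _+_ (List.length-map (a ∷_) (choices bs)) (length-product as))

infix 4 _≤ᵛ_
_≤ᵛ_ : ∀ {k} → Vec ℕ k → Vec ℕ k → Set
u ≤ᵛ v = ∀ j → lookup u j ≤ lookup v j

-- The product is listed lexicographically, and the lexicographic order extends the componentwise
-- one. This lets the targets of transitions precede their sources in the table.
choices-ascending : ∀ {B : Set} {f : B → List ℕ} → (∀ b → AllPairs _<_ (f b)) →
                    ∀ {k} (bs : Vec B k) → AllPairs (λ u v → ¬ v ≤ᵛ u) (choices f bs)
choices-ascending asc []       = [] ∷ []
choices-ascending {f = f} asc (b ∷ bs) = go (asc b)
  where
  go : ∀ {as} → AllPairs _<_ as →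
       AllPairs (λ u v → ¬ v ≤ᵛ u) (cartesianProductWith _∷_ as (choices f bs))
  go []                  = []
  go {a ∷ as} (a< ∷ as!) = AllPairs.++⁺
    (AllPairs.map⁺ (AllPairs.map (λ v≰u v≤u → v≰u (v≤u ∘ suc)) (choices-ascending asc bs)))
    (go as!)
    (All.map⁺ (All.universal (λ u → All.tabulate (beyond u)) (choices f bs)))
    where
    beyond : ∀ u {v} → v ∈ cartesianProductWith _∷_ as (choices f bs) → ¬ v ≤ᵛ (a ∷ u)
    beyond u v∈ v≤u with _ , _ , a′∈ , _ , refl ← ∈-cartesianProductWith⁻ _∷_ as (choices f bs) v∈ =
      ℕ.<⇒≱ (All.lookup a< a′∈) (v≤u zero)

sum-≤ᵛ : ∀ {k} (u v : Vec ℕ k) → u ≤ᵛ v → Vec.sum u ≤ Vec.sum v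
sum-≤ᵛ []      []      _   = z≤n
sum-≤ᵛ (_ ∷ u) (_ ∷ v) u≤v = ℕ.+-mono-≤ (u≤v zero) (sum-≤ᵛ u v (u≤v ∘ suc))

-- The coordinate sum is the measure that bounds the length of a solution running through distinct
-- states.
sum-<ᵛ : ∀ {k} (u v : Vec ℕ k) → u ≤ᵛ v → u ≢ v → Vec.sum u < Vec.sum v
sum-<ᵛ []      []      _   u≢v = contradiction refl u≢v
sum-<ᵛ (a ∷ u) (b ∷ v) u≤v u≢v with a ℕ.≟ b
... | yes refl = ℕ.+-monoʳ-< a (sum-<ᵛ u v (u≤v ∘ suc) (u≢v ∘ cong (a ∷_)))
... | no  a≢b  = ℕ.+-mono-<-≤ (ℕ.≤∧≢⇒< (u≤v zero) a≢b) (sum-≤ᵛ u v (u≤v ∘ suc))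

sum-mono : ∀ {k} {c d : Fin k → ℚ} → (∀ j → c j ℚ.≤ d j) → sum c ℚ.≤ sum d
sum-mono {zero}  _   = ℚ.≤-refl
sum-mono {suc k} c≤d = ℚ.+-mono-≤ (c≤d zero) (sum-mono (c≤d ∘ suc))

-- Samples matched with one element of the mean

module _ {I : Set} where

  -- Every matched entry carries the weight of its series, so the joint cost of an element against
  -- all k blocks is a single `spread`.
  samples : ∀ {k} → (Fin k → I) → (Fin k → ℕ → I) → Vec (List ℕ) k → List (I × I)
  samples wt ys []       = []
  samples wt ys (B ∷ Bs) = map (λ b → wt zero , ys zero b) B ++ samples (wt ∘ suc) (ys ∘ suc) Bs

  length-samples : ∀ {k n} (wt : Fin k → I) ys Bs → (∀ j → length (lookup Bs j) ≤ n) →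
                   length (samples wt ys Bs) ≤ k * n
  length-samples wt ys []       _  = z≤n
  length-samples wt ys (B ∷ Bs) ≤n = subst (_≤ _) (sym (List.length-++ (map _ B)))
    (ℕ.+-mono-≤ (subst (_≤ _) (sym (List.length-map _ B)) (≤n zero))
                (length-samples (wt ∘ suc) (ys ∘ suc) Bs (≤n ∘ suc)))

module Samples {I : Set} (ι : I → ℚ) where
  open WeightedMean ι

  weighted-samples : ∀ {k} (wt : Fin k → I) ys Bs → (∀ j → 0ℚ ℚ.≤ ι (wt j)) →
                     All Weighted (samples wt ys Bs)
  weighted-samples wt ys []       _   = []
  weighted-samples wt ys (B ∷ Bs) 0≤w = All.++⁺ (All.map⁺ (All.universal (λ _ → 0≤w zero) B))
    (weighted-samples (wt ∘ suc) (ys ∘ suc) Bs (0≤w ∘ suc))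

  spread-block : ∀ z w (y : ℕ → I) B ps → spread z (map (λ b → w , y b) B ++ ps) ≡
                 ι w ℚ.* blockCost (ι ∘ y) z B ℚ.+ spread z ps
  spread-block z w y []      ps = sym (trans (cong (ℚ._+ _) (ℚ.*-zeroʳ (ι w))) (ℚ.+-identityˡ _))
  spread-block z w y (b ∷ B) ps = begin
    q ℚ.+ spread z (map (λ b → w , y b) B ++ ps)  ≡⟨ cong (q ℚ.+_) (spread-block z w y B ps) ⟩
    q ℚ.+ (ι w ℚ.* c ℚ.+ spread z ps)             ≡⟨ ℚ.+-assoc q _ _ ⟨
    q ℚ.+ ι w ℚ.* c ℚ.+ spread z ps               ≡⟨ cong (ℚ._+ _) (ℚ.*-distribˡ-+ (ι w) _ c) ⟨
    ι w ℚ.* blockCost (ι ∘ y) z (b ∷ B) ℚ.+ spread z ps ∎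
    where
    open ≡-Reasoning
    q = ι w ℚ.* (z ℚ.- ι (y b)) ²
    c = blockCost (ι ∘ y) z B

  spread-samples : ∀ {k} z (wt : Fin k → I) ys Bs → spread z (samples wt ys Bs) ≡
                   sum (λ j → ι (wt j) ℚ.* blockCost (ι ∘ ys j) z (lookup Bs j))
  spread-samples z wt ys []       = refl
  spread-samples z wt ys (B ∷ Bs) = trans (spread-block z (wt zero) (ys zero) B _)
    (cong (ι (wt zero) ℚ.* blockCost (ι ∘ ys zero) z B ℚ.+_) (spread-samples z (wt ∘ suc) (ys ∘ suc) Bs))

  0≤spread : ∀ {ps} → All Weighted ps → ∀ z → 0ℚ ℚ.≤ spread z ps
  0≤spread []           z = ℚ.≤-refl
  0≤spread {(_ , x) ∷ _} (0≤w ∷ 0≤ws) z = 0≤p+q (0≤p*q 0≤w (0≤q² (z ℚ.- ι x))) (0≤spread 0≤ws z)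

-- Dynamic programming

module DynamicProgram {I : Set} {k : ℕ} (wt : Fin k → I) (ys : Fin k → ℕ → I) where

  -- The value of an optimal solution of a subproblem, and the solution itself.
  Entry : Set
  Entry = Operand I × ∃ λ l → Vec (Operand I) (suc l)

  State Transition : Set
  State      = Vec ℕ k
  Transition = Vec Move k

  blocks : Transition → Vec (List ℕ) k
  blocks = Vec.map proj₁

  target : Transition → State
  target = Vec.map proj₂

  transitions : State → List Transition
  transitions = choices moves

  finalBlocks : State → Vec (List ℕ) k
  finalBlocks = Vec.map (downFrom ∘ suc)

  _≟ᵛ_ : (u v : State) → Dec (u ≡ v)
  _≟ᵛ_ = Vec.≡-dec ℕ._≟_

  -- Transitions back to `v` are skipped, as they would refer to the subproblem being solved. The
  -- rest of the program occurs in both branches of the comparison, so the better candidate is known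
  -- there without storing any pointer.
  relax : (State → Entry) → State → List Transition → Entry → ℕ →
          (ℕ → Entry → Program I) → Program I
  relax memo v []       best n κ = κ n best
  relax memo v (e ∷ es) best n κ with target e ≟ᵛ v
  ... | yes _ = relax memo v es best n κ
  ... | no  _ = extend (samples wt ys (blocks e)) (proj₁ (memo (target e))) n λ n m u →
    compare u (proj₁ best)
      (relax memo v es (u , _ , m ∷ proj₂ (proj₂ (memo (target e)))) n κ)
      (relax memo v es best n κ)

  update : (State → Entry) → State → Entry → State → Entry
  update memo v best s with s ≟ᵛ v
  ... | yes _ = best
  ... | no  _ = memo s

  -- The candidate that ends the mean in `v` opens the search, so no infinite initial value is
  -- required.
  fillTable : List State → (State → Entry) → ℕ → ((State → Entry) → Program I) → Program I
  fillTable []       memo n κ = κ memo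
  fillTable (v ∷ vs) memo n κ = extend (samples wt ys (finalBlocks v)) 0# n λ n m u →
    relax memo v (transitions v) (u , _ , m ∷ []) n λ n best →
    fillTable vs (update memo v best) n κ

  box : State → List State
  box = choices (upTo ∘ suc)

  box-ascending : ∀ L → AllPairs (λ u v → ¬ v ≤ᵛ u) (box L)
  box-ascending L = choices-ascending (λ b → AllPairs.applyUpTo⁺₁ _ (suc b) (λ i<j _ → i<j)) L

  ∈-box⁺ : ∀ L v → v ≤ᵛ L → v ∈ box L
  ∈-box⁺ L v v≤L = ∈-choices⁺ (upTo ∘ suc) v L λ j → ∈-upTo⁺ (s≤s (v≤L j))

  ∈-box⁻ : ∀ L {v} → v ∈ box L → v ≤ᵛ L
  ∈-box⁻ L v∈ j = ℕ.≤-pred (∈-upTo⁻ (∈-choices⁻ (upTo ∘ suc) L v∈ j))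

  -- `extend` on at most N samples costs 32 N + 8, a comparison 3 more. A state pays for its final
  -- blocks and for at most (2n)^k transitions.
  perMove perState : ℕ → ℕ
  perMove N  = 32 * N + 11
  perState n = 32 * (k * n) + 8 + (2 * n) ^ k * perMove (k * n)

  -- Correctness and cost of the dynamic program

  module Correct (ι : I → ℚ) (0≤wt : ∀ j → 0ℚ ℚ.≤ ι (wt j)) where
    open WeightedMean ι
    open Samples ι
    open Machine ι

    Walks : List ℚ → State → (Fin k → ℚ) → Set
    Walks zs v cs = ∀ j → Walk (ι ∘ ys j) zs (lookup v j) (cs j)

    weigh : (Fin k → ℚ) → ℚ
    weigh cs = sum (λ j → ι (wt j) ℚ.* cs j)

    weigh-split : ∀ {cs rs} z Bs →
      (∀ j → cs j ≡ blockCost (ι ∘ ys j) z (lookup Bs j) ℚ.+ rs j) →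
      weigh cs ≡ spread z (samples wt ys Bs) ℚ.+ weigh rs
    weigh-split {cs} {rs} z Bs eq = begin
      weigh cs ≡⟨ sum-cong-≗ (λ j → trans (cong (ι (wt j) ℚ.*_) (eq j)) (ℚ.*-distribˡ-+ (ι (wt j)) _ _)) ⟩
      sum (λ j → ι (wt j) ℚ.* blockCost (ι ∘ ys j) z (lookup Bs j) ℚ.+ ι (wt j) ℚ.* rs j)
        ≡⟨ ∑-distrib-+ (λ j → ι (wt j) ℚ.* blockCost (ι ∘ ys j) z (lookup Bs j)) (λ j → ι (wt j) ℚ.* rs j) ⟩
      sum (λ j → ι (wt j) ℚ.* blockCost (ι ∘ ys j) z (lookup Bs j)) ℚ.+ weigh rs
        ≡⟨ cong (ℚ._+ weigh rs) (spread-samples z wt ys Bs) ⟨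
      spread z (samples wt ys Bs) ℚ.+ weigh rs ∎
      where open ≡-Reasoning

    LowerBound : State → ℚ → Set
    LowerBound v d = ∀ z zs cs → Walks (z ∷ zs) v cs → d ℚ.≤ weigh cs

    -- The value is attained by explicit walks. `short` serves to charge for the output; the index
    -- that it bounds is the length minus 1.
    record Realises (W : World) (v : State) (best : Entry) (d : ℚ) : Set where
      field
        {series}  : Vec ℚ _
        {costs}   : Fin k → ℚ
        value⇓    : W ⊢ proj₁ best ⇓ d
        series⇓   : W ⊢* proj₂ (proj₂ best) ⇓ series
        walks     : Walks (toList series) v costs
        value≡    : weigh costs ≡ d
        short     : proj₁ (proj₂ best) ≤ Vec.sum v

    Realises-mono : ∀ {W W′ v best d} → W ⊑ W′ → Realises W v best d → Realises W′ v best d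
    Realises-mono W⊑ r = record
      { value⇓ = ⇓-mono W⊑ value⇓ ; series⇓ = ⇓*-mono W⊑ series⇓
      ; walks = walks ; value≡ = value≡ ; short = short }
      where open Realises r

    Optimal : World → State → Entry → Set
    Optimal W v best = ∃ λ d → Realises W v best d × LowerBound v d

    Optimal-mono : ∀ {W W′ v best} → W ⊑ W′ → Optimal W v best → Optimal W′ v best
    Optimal-mono W⊑ (d , r , lb) = d , Realises-mono W⊑ r , lb

    realises-final : ∀ {W v u m z} → W ⊢ m ⇓ z →
      W ⊢ u ⇓ spread z (samples wt ys (finalBlocks v)) ℚ.+ 0ℚ →
      Realises W v (u , _ , m ∷ []) (spread z (samples wt ys (finalBlocks v)) ℚ.+ 0ℚ)
    realises-final {v = v} {z = z} M U = record
      { costs = λ j → blockCost (ι ∘ ys j) z (downFrom (suc (lookup v j)))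
      ; value⇓ = U ; series⇓ = M ∷ []
      ; walks = λ j → walk-last⁺ (lookup v j)
      ; value≡ = trans (sum-cong-≗ λ j → cong (λ B → ι (wt j) ℚ.* blockCost (ι ∘ ys j) z B)
                          (sym (Vec.lookup-map j _ v)))
                 (trans (sym (spread-samples z wt ys (finalBlocks v))) (sym (ℚ.+-identityʳ _)))
      ; short = z≤n }

    target-≤ : ∀ v {e} → e ∈ transitions v → target e ≤ᵛ v
    target-≤ v {e} e∈ j = subst (_≤ lookup v j) (sym (Vec.lookup-map j proj₂ e))
      (proj₂ (moves-bounds (lookup v j) (∈-choices⁻ moves v e∈ j)))

    realises-step : ∀ {W v e u m z best d} → e ∈ transitions v → target e ≢ v →
      Realises W (target e) best d → W ⊢ m ⇓ z →
      W ⊢ u ⇓ spread z (samples wt ys (blocks e)) ℚ.+ d →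
      Realises W v (u , _ , m ∷ proj₂ (proj₂ best)) (spread z (samples wt ys (blocks e)) ℚ.+ d)
    realises-step {v = v} {e} {z = z} e∈ e≢ r M U = record
      { costs = λ j → blockCost (ι ∘ ys j) z (proj₁ (lookup e j)) ℚ.+ costs j
      ; value⇓ = U ; series⇓ = M ∷ series⇓
      ; walks = λ j → walk-cons⁺ (lookup v j) (∈-choices⁻ moves v e∈ j)
                  (subst (λ t → Walk _ _ t (costs j)) (Vec.lookup-map j proj₂ e) (walks j))
      ; value≡ = trans (weigh-split z (blocks e) λ j →
                   cong (λ B → blockCost (ι ∘ ys j) z B ℚ.+ costs j) (sym (Vec.lookup-map j proj₁ e)))
                 (cong (spread z (samples wt ys (blocks e)) ℚ.+_) value≡)
      -- A change of state lowers the coordinate sum by at least 1, which pays for the added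
      -- element.
      ; short = ℕ.≤-<-trans short (sum-<ᵛ (target e) v (target-≤ v e∈) e≢) }
      where open Realises r

    StepBound : ℚ → Transition → Set
    StepBound d e = ∀ z z′ zs cs → Walks (z′ ∷ zs) (target e) cs →
      d ℚ.≤ spread z (samples wt ys (blocks e)) ℚ.+ weigh cs

    -- An element of the mean that leaves the state unchanged is redundant.
    lower-bound : ∀ {v d} → (∀ z → d ℚ.≤ spread z (samples wt ys (finalBlocks v))) →
      (∀ {e} → e ∈ transitions v → target e ≢ v → StepBound d e) → LowerBound v d
    lower-bound {v} {d} final step z [] cs ws = ℚ.≤-trans (final z) (ℚ.≤-reflexive
      (trans (spread-samples z wt ys (finalBlocks v)) (sum-cong-≗ λ j → cong (ι (wt j) ℚ.*_)
        (trans (cong (blockCost (ι ∘ ys j) z) (Vec.lookup-map j _ v)) (sym (walk-last⁻ (ws j)))))))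
    lower-bound {v} {d} final step z (z′ ∷ zs) cs ws =
      subst (d ℚ.≤_) (sym (weigh-split z (blocks e) costs′)) bound
      where
      s : ∀ j → Split z (z′ ∷ zs) (lookup v j) (cs j)
      s j = walk-cons⁻ (ws j)
      e : Transition
      e = tabulate (Split.move ∘ s)
      rs : Fin k → ℚ
      rs j = Split.rest (s j)
      lookup-e : ∀ {A : Set} (f : Move → A) j → lookup (Vec.map f e) j ≡ f (Split.move (s j))
      lookup-e f j = trans (Vec.lookup-map j f e) (cong f (Vec.lookup∘tabulate (Split.move ∘ s) j))
      costs′ : ∀ j → cs j ≡ blockCost (ι ∘ ys j) z (lookup (blocks e) j) ℚ.+ rs j
      costs′ j = trans (Split.costs (s j))
        (cong (λ B → blockCost (ι ∘ ys j) z B ℚ.+ rs j) (sym (lookup-e proj₁ j)))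
      e∈ : e ∈ transitions v
      e∈ = ∈-choices⁺ moves e v λ j → subst (_∈ moves (lookup v j))
        (sym (Vec.lookup∘tabulate (Split.move ∘ s) j)) (Split.possible (s j))
      rest-walks : Walks (z′ ∷ zs) (target e) rs
      rest-walks j = subst (λ t → Walk _ _ t (rs j)) (sym (lookup-e proj₂ j)) (Split.onward (s j))
      bound : d ℚ.≤ spread z (samples wt ys (blocks e)) ℚ.+ weigh rs
      bound with target e ≟ᵛ v
      ... | no  e≢v = step e∈ e≢v z z′ zs rs rest-walks
      ... | yes e≡v = ℚ.≤-trans
        (lower-bound final step z′ zs rs (subst (λ v → Walks (z′ ∷ zs) v rs) e≡v rest-walks))
        (q≤p+q _ (0≤spread (weighted-samples wt ys (blocks e) 0≤wt) z))

    mean-minimal : ∀ Bs z → spread (mean (samples wt ys Bs)) (samples wt ys Bs) ℚ.≤ spread z (samples wt ys Bs)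
    mean-minimal Bs = mean-optimal (weighted-samples wt ys Bs 0≤wt)

    module _ (R : 𝒯 → Set) {N : ℕ} where

      -- The value of the best candidate never increases, so the bound gained from one transition
      -- survives all later ones, and the continuation receives the bounds for the whole list.
      relax-outcome : ∀ {W} memo v es best {d κ b} → Realises W v best d →
        All (λ e → e ∈ transitions v) es →
        All (λ e → length (samples wt ys (blocks e)) ≤ N) es →
        (∀ {e} → e ∈ transitions v → target e ≢ v → Optimal W (target e) (memo (target e))) →
        (∀ {W′ best′ d′} → W ⊑ W′ → Realises W′ v best′ d′ → d′ ℚ.≤ d →
           All (λ e → target e ≢ v → StepBound d′ e) es → Outcome R (κ (proj₁ W′) best′) (proj₂ W′) b) →
        Outcome R (relax memo v es best (proj₁ W) κ) (proj₂ W) (length es * perMove N + b)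
      relax-outcome memo v [] best r _ _ _ K = K ⊑-refl r ℚ.≤-refl []
      relax-outcome {W} memo v (e ∷ es) best {d} {κ} {b} r (e∈ ∷ es∈) (e≤N ∷ es≤N) opt K
        with target e ≟ᵛ v
      ... | yes e≡v = Outcome-≤ R (ℕ.+-monoˡ-≤ b (ℕ.m≤n+m _ (perMove N)))
        (relax-outcome memo v es best r es∈ es≤N opt
          λ W⊑ r′ d′≤ sb → K W⊑ r′ d′≤ ((λ e≢v → contradiction e≡v e≢v) ∷ sb))
      ... | no e≢v with opt e∈ e≢v
      ... | c , rₑ , lbₑ = Outcome-≤ R count
        (extend-outcome R ps (Realises.value⇓ rₑ) λ W⊑₁ M U →
         let r₁ = Realises-mono W⊑₁ r
             rₙ = realises-step e∈ e≢v (Realises-mono W⊑₁ rₑ) M U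
             opt₁ : ∀ {e} → e ∈ transitions v → target e ≢ v → Optimal _ (target e) (memo (target e))
             opt₁ e∈ e≢ = Optimal-mono W⊑₁ (opt e∈ e≢) in
         compare-outcome R U (Realises.value⇓ r₁)
           (λ new≤ → relax-outcome memo v es _ rₙ es∈ es≤N opt₁
             λ W⊑₂ r₂ d₂≤ sb → K (⊑-trans W⊑₁ W⊑₂) r₂ (ℚ.≤-trans d₂≤ new≤) ((λ _ → sb′ d₂≤) ∷ sb))
           (λ old≤ → relax-outcome memo v es best r₁ es∈ es≤N opt₁
             λ W⊑₂ r₂ d₂≤ sb → K (⊑-trans W⊑₁ W⊑₂) r₂ d₂≤ ((λ _ → sb′ (ℚ.≤-trans d₂≤ old≤)) ∷ sb)))
        where
        ps : List (I × I)
        ps = samples wt ys (blocks e)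
        -- The element and the remaining series vary independently, so the two summands are
        -- minimized separately.
        sb′ : ∀ {d′} → d′ ℚ.≤ spread (mean ps) ps ℚ.+ c → StepBound d′ e
        sb′ d′≤ z z′ zs cs ws = ℚ.≤-trans d′≤ (ℚ.+-mono-≤ (mean-minimal (blocks e) z) (lbₑ z′ zs cs ws))
        count : 32 * length ps + 8 + (3 + (length es * perMove N + b)) ≤ length (e ∷ es) * perMove N + b
        count = begin
          32 * length ps + 8 + (3 + (length es * perMove N + b))
            ≤⟨ ℕ.+-monoˡ-≤ _ (ℕ.+-monoˡ-≤ 8 (ℕ.*-monoʳ-≤ 32 e≤N)) ⟩
          32 * N + 8 + (3 + (length es * perMove N + b))
            ≡⟨ solve 3 (λ n l b → n :+ con 8 :+ (con 3 :+ (l :+ b)) := n :+ con 11 :+ l :+ b)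
                 refl (32 * N) (length es * perMove N) b ⟩
          length (e ∷ es) * perMove N + b ∎
          where
          open ℕ.≤-Reasoning
          open ℕ-Solver.+-*-Solver

    module _ {L : State} {n : ℕ} (L<n : ∀ j → lookup L j < n) where

      private
        N : ℕ
        N = k * n

      <n : ∀ v → v ≤ᵛ L → ∀ j → lookup v j < n
      <n v v≤L j = ℕ.≤-<-trans (v≤L j) (L<n j)

      finalBlocks≤N : ∀ v → v ≤ᵛ L → length (samples wt ys (finalBlocks v)) ≤ N
      finalBlocks≤N v v≤L = length-samples wt ys (finalBlocks v) λ j → subst (_≤ n)
        (sym (trans (cong length (Vec.lookup-map j (downFrom ∘ suc) v))
                    (List.length-downFrom (suc (lookup v j)))))
        (<n v v≤L j)

      blocks≤N : ∀ v {e} → v ≤ᵛ L → e ∈ transitions v → length (samples wt ys (blocks e)) ≤ N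
      blocks≤N v {e} v≤L e∈ = length-samples wt ys (blocks e) λ j → subst (_≤ n)
        (sym (cong length (Vec.lookup-map j proj₁ e)))
        (ℕ.≤-trans (proj₁ (moves-bounds (lookup v j) (∈-choices⁻ moves v e∈ j))) (<n v v≤L j))

      length-transitions : ∀ v → v ≤ᵛ L → length (transitions v) ≤ (2 * n) ^ k
      length-transitions v v≤L = length-choices moves v λ j →
        ℕ.≤-trans (length-moves (lookup v j)) (ℕ.*-monoʳ-≤ 2 (<n v v≤L j))

      update-optimal : ∀ {W W′} vs {v best} {memo : State → Entry} → W ⊑ W′ → Optimal W′ v best →
        (∀ s → s ≤ᵛ L → s ∈ v ∷ vs ⊎ Optimal W s (memo s)) →
        ∀ s → s ≤ᵛ L → s ∈ vs ⊎ Optimal W′ s (update memo v best s)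
      update-optimal vs {v} W⊑ opt cover s s≤L with s ≟ᵛ v
      ... | yes refl = inj₂ opt
      ... | no s≢v with cover s s≤L
      ... | inj₁ (here s≡v) = contradiction s≡v s≢v
      ... | inj₁ (there s∈) = inj₁ s∈
      ... | inj₂ o          = inj₂ (Optimal-mono W⊑ o)

      -- Invariant: each state of the box is pending or has an optimal entry. A transition that
      -- leaves `v` leads to a componentwise smaller state, which the order of the list excludes
      -- from the pending ones.
      fillTable-outcome : ∀ (R : 𝒯 → Set) {W} vs memo {κ b} →
        AllPairs (λ u v → ¬ v ≤ᵛ u) vs → All (_≤ᵛ L) vs →
        (∀ s → s ≤ᵛ L → s ∈ vs ⊎ Optimal W s (memo s)) →
        (∀ {W′} memo′ → (∀ s → s ≤ᵛ L → Optimal W′ s (memo′ s)) → Outcome R (κ memo′) (proj₂ W′) b) →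
        Outcome R (fillTable vs memo (proj₁ W) κ) (proj₂ W) (length vs * perState n + b)
      fillTable-outcome R [] memo _ _ cover K = K memo λ s s≤L → case cover s s≤L of λ { (inj₂ o) → o }
      fillTable-outcome R {W} (v ∷ vs) memo {κ} {b} (v! ∷ vs!) (v≤L ∷ vs≤L) cover K = Outcome-≤ R count
        (extend-outcome R ps (tt , refl) λ W⊑₁ M U →
         relax-outcome R memo v (transitions v) _ (realises-final M U) (All.tabulate λ e∈ → e∈)
           (All.tabulate (blocks≤N v v≤L)) (λ e∈ e≢v → Optimal-mono W⊑₁ (earlier e∈ e≢v))
           λ {_} {best} W⊑₂ r d≤ sb → fillTable-outcome R vs (update memo v best) vs! vs≤L
             (update-optimal vs (⊑-trans W⊑₁ W⊑₂) (_ , r , lower-bound {v}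
               (λ z → ℚ.≤-trans d≤ (ℚ.≤-trans (ℚ.≤-reflexive (ℚ.+-identityʳ _)) (mean-minimal (finalBlocks v) z)))
               (All.lookup sb)) cover) K)
        where
        ps : List (I × I)
        ps = samples wt ys (finalBlocks v)
        earlier : ∀ {e} → e ∈ transitions v → target e ≢ v → Optimal W (target e) (memo (target e))
        earlier {e} e∈ e≢v with cover (target e) (λ j → ℕ.≤-trans (target-≤ v e∈ j) (v≤L j))
        ... | inj₁ (here e≡v) = contradiction e≡v e≢v
        ... | inj₁ (there e∈vs) = contradiction (target-≤ v e∈) (All.lookup v! e∈vs)
        ... | inj₂ o = o
        count : 32 * length ps + 8 + (length (transitions v) * perMove N + (length vs * perState n + b)) ≤
                length (v ∷ vs) * perState n + b
        count = begin
          32 * length ps + 8 + (length (transitions v) * perMove N + (length vs * perState n + b))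
            ≤⟨ ℕ.+-mono-≤ (ℕ.+-monoˡ-≤ 8 (ℕ.*-monoʳ-≤ 32 (finalBlocks≤N v v≤L)))
                (ℕ.+-monoˡ-≤ _ (ℕ.*-monoˡ-≤ (perMove N) (length-transitions v v≤L))) ⟩
          32 * N + 8 + ((2 * n) ^ k * perMove N + (length vs * perState n + b))
            ≡⟨ solve 4 (λ f m l b → f :+ (m :+ (l :+ b)) := f :+ m :+ l :+ b) refl
                 (32 * N + 8) ((2 * n) ^ k * perMove N) (length vs * perState n) b ⟩
          length (v ∷ vs) * perState n + b ∎
          where
          open ℕ.≤-Reasoning
          open ℕ-Solver.+-*-Solver

      length-box : length (box L) ≤ n ^ k
      length-box = length-choices (upTo ∘ suc) L λ j →
        subst (_≤ n) (sym (List.length-upTo (suc (lookup L j)))) (L<n j)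

-- Warping paths as walks

drop-lookup : ∀ {A : Set} {n} (v : Vec A n) i →
              drop (toℕ i) (toList v) ≡ lookup v i ∷ drop (suc (toℕ i)) (toList v)
drop-lookup (_ ∷ v) zero    = refl
drop-lookup (_ ∷ v) (suc i) = drop-lookup v i

successor : ∀ {A : Set} {n} (v : Vec A n) (i : Fin n) {a as} →
            drop (suc (toℕ i)) (toList v) ≡ a ∷ as → ∃ λ i′ → toℕ i′ ≡ suc (toℕ i)
successor {n = n} v i eq with suc (toℕ i) ℕ.<? n
... | yes i<n = fromℕ< i<n , Fin.toℕ-fromℕ< i<n
... | no  i≮n with () ← trans (sym eq) (List.drop-all (suc (toℕ i)) (toList v)
                          (subst (_≤ suc (toℕ i)) (sym (Vec.length-toList v)) (ℕ.≮⇒≥ i≮n)))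

module _ {b : ℕ} where

  -- The entry of a series of length b + 1 that is followed by m others.
  fromEnd : ℕ → Fin (suc b)
  fromEnd m = fromℕ< (s≤s (ℕ.m∸n≤m b m))

  fromEnd-∸ : ∀ j → fromEnd (b ∸ toℕ j) ≡ j
  fromEnd-∸ j = Fin.toℕ-injective (trans (Fin.toℕ-fromℕ< _) (ℕ.m∸[m∸n]≡n (Fin.toℕ≤pred[n] j)))

  ∸-step : ∀ {j j′ : Fin (suc b)} → toℕ j′ ≡ suc (toℕ j) → b ∸ toℕ j ≡ suc (b ∸ toℕ j′)
  ∸-step {j} {j′} e = trans (ℕ.+-∸-assoc 1 (subst (_≤ b) e (Fin.toℕ≤pred[n] j′)))
                            (cong (λ t → suc (b ∸ t)) (sym e))

module PathsAndWalks {a b} (z : Vec ℚ (suc a)) (x : Vec ℚ (suc b)) where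

  y : ℕ → ℚ
  y m = lookup x (fromEnd m)

  zs : List ℚ
  zs = toList z

  gap : ∀ i j → (lookup z i ℚ.- y (b ∸ toℕ j)) ² ≡ (lookup z i ℚ.- lookup x j) ²
  gap i j = cong (λ j → (lookup z i ℚ.- lookup x j) ²) (fromEnd-∸ j)

  end : Point (suc a) (suc b)
  end = fromℕ a , fromℕ b

  -- Position `i` becomes the suffix of `zs` that starts there, and `j` the number `b ∸ toℕ j` of
  -- entries to come. `go` writes entries as values of `y`, so that this number can be rewritten by
  -- `∸-step`.
  path⇒walk : ∀ i j p → last ((i , j) ∷ p) ≡ just end → Linked _⇝_ ((i , j) ∷ p) →
              Walk y (drop (toℕ i) zs) (b ∸ toℕ j) (cost (a , z) (b , x) ((i , j) ∷ p))
  path⇒walk i j p l s = subst₂ (λ zs c → Walk y zs (b ∸ toℕ j) c)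
    (sym (drop-lookup z i)) (cong (ℚ._+ C p) (gap i j)) (go p l s)
    where
    tail : List ℚ
    tail = drop (suc (toℕ i)) zs
    C : List (Point (suc a) (suc b)) → ℚ
    C = cost (a , z) (b , x)
    Row : ℚ → ℕ → Set
    Row c m = Walk y (lookup z i ∷ tail) m ((lookup z i ℚ.- y m) ² ℚ.+ c)
    next : ∀ {i′ m c} → toℕ i′ ≡ suc (toℕ i) → Walk y (drop (toℕ i′) zs) m c → Walk y tail m c
    next {m = m} {c} = subst (λ t → Walk y (drop t zs) m c)
    go : ∀ p → last ((i , j) ∷ p) ≡ just end → Linked _⇝_ ((i , j) ∷ p) → Row (C p) (b ∸ toℕ j)
    go [] refl _ = subst₂ (λ t m → Walk y (lookup z i ∷ t) m ((lookup z i ℚ.- y m) ² ℚ.+ 0ℚ))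
      (sym (List.drop-all (suc (toℕ i)) zs
        (ℕ.≤-reflexive (trans (Vec.length-toList z) (cong suc (sym (Fin.toℕ-fromℕ a)))))))
      (sym (trans (cong (b ∸_) (Fin.toℕ-fromℕ b)) (ℕ.n∸n≡0 b))) stop
    go ((i′ , _) ∷ p) l (step₁₀ e ∷ s) =
      walk₁₀ (next {i′} e (path⇒walk i′ j p l s))
    go ((_ , j′) ∷ p) l (step₀₁ e ∷ s) =
      subst (Row (C ((i , j′) ∷ p))) (sym (∸-step e))
        (walk₀₁ (subst (λ t → Walk y t (b ∸ toℕ j′) (C ((i , j′) ∷ p))) (drop-lookup z i)
          (path⇒walk i j′ p l s)))
    go ((i′ , j′) ∷ p) l (step₁₁ e e′ ∷ s) =
      subst (Row (C ((i′ , j′) ∷ p))) (sym (∸-step e′))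
        (walk₁₁ (next {i′} e (path⇒walk i′ j′ p l s)))

  record PathFrom (i : Fin (suc a)) (j : Fin (suc b)) (c : ℚ) : Set where
    constructor path
    field
      rest  : List (Point (suc a) (suc b))
      ends  : last ((i , j) ∷ rest) ≡ just end
      steps : Linked _⇝_ ((i , j) ∷ rest)
      costs : cost (a , z) (b , x) ((i , j) ∷ rest) ≡ c

  extendPath : ∀ {i j i′ j′ c} → (i , j) ⇝ (i′ , j′) → PathFrom i′ j′ c →
               PathFrom i j ((lookup z i ℚ.- y (b ∸ toℕ j)) ² ℚ.+ c)
  extendPath {i} {j} {i′} {j′} st (path p l s eq) =
    path ((i′ , j′) ∷ p) l (st ∷ s) (cong₂ ℚ._+_ (sym (gap i j)) eq)

  -- A walk mentions no positions. That a next row exists follows from the nonempty suffix walked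
  -- afterwards, and that a next column exists from `m` being a successor. The equations keep the
  -- indices variable for matching.
  walk⇒path : ∀ {t m c} → Walk y t m c → ∀ i j → t ≡ drop (toℕ i) zs → m ≡ b ∸ toℕ j → PathFrom i j c
  walk⇒path w i j t≡ m≡ = go w (trans t≡ (drop-lookup z i)) m≡
    where
    nonempty : ∀ {t m c} → Walk y t m c → ∃₂ λ q qs → t ≡ q ∷ qs
    nonempty stop       = _ , _ , refl
    nonempty (walk₁₀ _) = _ , _ , refl
    nonempty (walk₀₁ _) = _ , _ , refl
    nonempty (walk₁₁ _) = _ , _ , refl
    right : ∀ {m c} → Walk y (drop (suc (toℕ i)) zs) m c → ∃ λ i′ → toℕ i′ ≡ suc (toℕ i)
    right w = let _ , _ , eq = nonempty w in successor z i eq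
    up : ∀ {m} → suc m ≡ b ∸ toℕ j → ∃ λ j′ → toℕ j′ ≡ suc (toℕ j) × m ≡ b ∸ toℕ j′
    up {m} eq = j′ , e , ℕ.suc-injective (trans eq (∸-step e))
      where
      j<b : toℕ j < b
      j<b = ℕ.m∸n≢0⇒n<m (λ ≡0 → case trans eq ≡0 of λ ())
      j′ : Fin (suc b)
      j′ = fromℕ< (s≤s j<b)
      e : toℕ j′ ≡ suc (toℕ j)
      e = Fin.toℕ-fromℕ< (s≤s j<b)
    top : ∀ {n} (i : Fin (suc n)) → n ≤ toℕ i → i ≡ fromℕ n
    top i n≤i = Fin.toℕ-injective (trans (ℕ.≤-antisym (Fin.toℕ≤pred[n] i) n≤i) (sym (Fin.toℕ-fromℕ _)))
    go : ∀ {t m c} → Walk y t m c → t ≡ lookup z i ∷ drop (suc (toℕ i)) zs → m ≡ b ∸ toℕ j → PathFrom i j c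
    go stop t≡ m≡ = path [] (cong₂ (λ i j → just (i , j)) (top i a≤i) (top j (ℕ.m∸n≡0⇒m≤n (sym m≡)))) [-]
      (cong (ℚ._+ 0ℚ) (trans (sym (gap i j)) (cong₂ (λ q m → (q ℚ.- y m) ²) (sym (List.∷-injectiveˡ t≡)) (sym m≡))))
      where
      a≤i : a ≤ toℕ i
      a≤i = ℕ.≤-pred (ℕ.m∸n≡0⇒m≤n (trans (cong (_∸ suc (toℕ i)) (sym (Vec.length-toList z)))
              (trans (sym (List.length-drop (suc (toℕ i)) zs)) (cong length (sym (List.∷-injectiveʳ t≡))))))
    go (walk₁₀ w) refl refl =
      let i′ , e = right w in
      extendPath (step₁₀ e) (walk⇒path w i′ j (cong (λ n → drop n zs) (sym e)) refl)
    go (walk₀₁ {c = c} w) refl m≡ =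
      let j′ , e , m≡′ = up m≡ in
      subst (λ m → PathFrom i j ((lookup z i ℚ.- y m) ² ℚ.+ c)) (sym m≡)
        (extendPath (step₀₁ e) (walk⇒path w i j′ (sym (drop-lookup z i)) m≡′))
    go (walk₁₁ {c = c} w) refl m≡ =
      let i′ , d = right w ; j′ , e , m≡′ = up m≡ in
      subst (λ m → PathFrom i j ((lookup z i ℚ.- y m) ² ℚ.+ c)) (sym m≡)
        (extendPath (step₁₁ d e) (walk⇒path w i′ j′ (cong (λ n → drop n zs) (sym d)) m≡′))

  -- With `dtw²-≤` this makes the squared distance the least cost of a walk, the form in which the
  -- optimality argument uses it.
  dtw²-walk : Walk y zs b (dtw² (a , z) (b , x))
  dtw²-walk with dtw²-isMinimum (a , z) (b , x)
  ... | ([] , W , _) , _ with () ← IsWarpingPath.starts W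
  ... | (_ ∷ p , W , eq) , _ with refl ← IsWarpingPath.starts W =
    subst (Walk y zs b) eq (path⇒walk zero zero p (IsWarpingPath.ends W) (IsWarpingPath.steps W))

  dtw²-≤ : ∀ {c} → Walk y zs b c → dtw² (a , z) (b , x) ℚ.≤ c
  dtw²-≤ w with path p l s eq ← walk⇒path w zero zero refl refl =
    subst (_ ℚ.≤_) eq (proj₂ (dtw²-isMinimum (a , z) (b , x)) _
      (record { starts = refl ; ends = l ; steps = s }))

-- The algorithm and the arithmetic of its running time

module _ {k} (l : Fin k → ℕ) where

  -- Truncated subtraction sends indices that are too large to the first entry; states below
  -- `fullState` never reach them.
  elements : (j : Fin k) → ℕ → InputPos l
  elements j m = entry j (fromEnd m)

  open DynamicProgram (weight {l = l}) elements

  fullState : State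
  fullState = tabulate l

  -- The initial memo table is a placeholder: all states are pending at first, and each entry is set
  -- before it is read.
  meanProgram : Program (InputPos l)
  meanProgram = fillTable (box fullState) (λ _ → 0# , _ , 0# ∷ []) 0
    λ memo → output (proj₂ (proj₂ (memo fullState)))

len≤maxLength : ∀ {k} (x : Fin k → 𝒯) i → len (x i) ≤ maxLength x
len≤maxLength x zero    = ℕ.m≤m⊔n (len (x zero)) (maxLength (x ∘ suc))
len≤maxLength x (suc i) = ℕ.≤-trans (len≤maxLength (x ∘ suc) i) (ℕ.m≤n⊔m (len (x zero)) _)

-- The left side is the total input length, as each `l i` is a length minus 1. It is used to bound
-- the length of the output.
sum-tabulate : ∀ {k n} (l : Fin k → ℕ) → (∀ i → l i < n) → k + Vec.sum (tabulate l) ≤ k * n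
sum-tabulate {zero}      l l<n = z≤n
sum-tabulate {suc k} {n} l l<n = begin
  suc k + (l zero + Vec.sum (tabulate (l ∘ suc)))
    ≡⟨ solve 3 (λ k a s → con 1 :+ k :+ (a :+ s) := con 1 :+ a :+ (k :+ s)) refl k (l zero) _ ⟩
  suc (l zero) + (k + Vec.sum (tabulate (l ∘ suc))) ≤⟨ ℕ.+-mono-≤ (l<n zero) (sum-tabulate (l ∘ suc) (l<n ∘ suc)) ⟩
  n + k * n                                         ∎
  where
  open ℕ.≤-Reasoning
  open ℕ-Solver.+-*-Solver

^-distribʳ-* : ∀ m n o → (m * n) ^ o ≡ m ^ o * n ^ o
^-distribʳ-* m n zero    = refl
^-distribʳ-* m n (suc o) = trans (cong (m * n *_) (^-distribʳ-* m n o)) (*-interchange m n (m ^ o) (n ^ o))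

-- The leading term is n^k states times (2n)^k transitions times kn samples. The constant is 84 =
-- (32 + 8) + (32 + 11) + 1, for final blocks, transitions and output; lower terms are absorbed
-- because all factors are at least 1.
total-≤ : ∀ k n s → 1 ≤ k → 1 ≤ n → s ≤ n ^ k →
  s * (32 * (k * n) + 8 + (2 * n) ^ k * (32 * (k * n) + 11)) + k * n ≤
  84 * (n ^ (2 * k + 1) * 2 ^ k * k)
total-≤ k@(suc _) n@(suc _) s _ _ s≤X = begin
  s * (32 * N + 8 + P * (32 * N + 11)) + N
    ≤⟨ ℕ.+-mono-≤ (ℕ.*-mono-≤ s≤X (ℕ.+-mono-≤ final (ℕ.*-monoʳ-≤ P move))) N≤XPN ⟩
  X * (40 * (P * N) + P * (43 * N)) + X * (P * N)
    ≡⟨ solve 3 (λ x p n → x :* (con 40 :* (p :* n) :+ p :* (con 43 :* n)) :+ x :* (p :* n)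
         := con 84 :* (x :* (p :* n))) refl X P N ⟩
  84 * (X * (P * N))
    ≡⟨ cong (λ P → 84 * (X * (P * N))) {P} {2 ^ k * X} (^-distribʳ-* 2 n k) ⟩
  84 * (X * (2 ^ k * X * N))
    ≡⟨ solve 4 (λ x y k n → con 84 :* (x :* (y :* x :* (k :* n))) := con 84 :* (x :* x :* n :* y :* k))
         refl X (2 ^ k) k n ⟩
  84 * (X * X * n * 2 ^ k * k)
    ≡⟨ cong (λ t → 84 * (t * 2 ^ k * k)) power ⟨
  84 * (n ^ (2 * k + 1) * 2 ^ k * k) ∎
  where
  open ℕ.≤-Reasoning
  open ℕ-Solver.+-*-Solver
  N = k * n
  X = n ^ k
  P = (2 * n) ^ k
  N≤PN : N ≤ P * N
  N≤PN = ℕ.m≤n*m N P {{ℕ.m^n≢0 (2 * n) k}}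
  N≤XPN : N ≤ X * (P * N)
  N≤XPN = ℕ.≤-trans N≤PN (ℕ.m≤n*m (P * N) X {{ℕ.m^n≢0 n k}})
  affine : ∀ a b → a * N + b ≤ (a + b) * N
  affine a b = begin
    a * N + b     ≤⟨ ℕ.+-monoʳ-≤ (a * N) (ℕ.m≤m*n b N) ⟩
    a * N + b * N ≡⟨ ℕ.*-distribʳ-+ N a b ⟨
    (a + b) * N   ∎
  final : 32 * N + 8 ≤ 40 * (P * N)
  final = ℕ.≤-trans (affine 32 8) (ℕ.*-monoʳ-≤ 40 N≤PN)
  move : 32 * N + 11 ≤ 43 * N
  move = affine 32 11
  power : n ^ (2 * k + 1) ≡ X * X * n
  power = begin-equality
    n ^ (2 * k + 1)             ≡⟨ ℕ.^-distribˡ-+-* n (2 * k) 1 ⟩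
    n ^ (2 * k) * (n * 1)       ≡⟨ cong₂ _*_
      (trans (cong (λ j → n ^ (k + j)) (ℕ.+-identityʳ k)) (ℕ.^-distribˡ-+-* n k k)) (ℕ.*-identityʳ n) ⟩
    X * X * n                   ∎

-- Optimality of the output

module _ {k} (x : Fin k → 𝒯) (w : Fin k → ℚ) (0≤w : ∀ i → 0ℚ ℚ.≤ w i) where

  private
    l : Fin k → ℕ
    l i = proj₁ (x i)

  open DynamicProgram (weight {l = l}) (elements l)
  open Correct (inputs w x) 0≤w
  open Machine (inputs w x)

  fullState-< : ∀ {n} → (∀ i → l i < n) → ∀ i → lookup (fullState l) i < n
  fullState-< {n} l<n i = subst (_< n) (sym (Vec.lookup∘tabulate l i)) (l<n i)

  weigh-mono : ∀ {c d : Fin k → ℚ} → (∀ i → c i ℚ.≤ d i) → weigh c ℚ.≤ weigh d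
  weigh-mono c≤d = sum-mono λ i → ℚ.*-monoˡ-≤-nonNeg (w i) {{ℚ.nonNegative (0≤w i)}} (c≤d i)

  -- The walks behind `best` bound its distances from above. A competitor `z` of any length enters
  -- the lower bound through its own cheapest walks.
  Fréchet-minimal : ∀ {W best} → Optimal W (fullState l) best →
    ∀ z → Fréchet w x (_ , Vec.map (value (inputs w x) (proj₂ W)) (proj₂ (proj₂ best))) ℚ.≤ Fréchet w x z
  Fréchet-minimal {W} {best} (d , r , lb) z@(_ , q ∷ qs) = begin
    Fréchet w x (_ , Vec.map (value (inputs w x) (proj₂ W)) (proj₂ (proj₂ best)))
      ≡⟨ cong (λ s → Fréchet w x (_ , s)) (⇓*⇒≡ series⇓) ⟩
    Fréchet w x (_ , series) ≤⟨ weigh-mono dtw²≤costs ⟩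
    weigh costs              ≡⟨ value≡ ⟩
    d                        ≤⟨ lb q (toList qs) (λ i → dtw² z (x i)) dtw²-walks ⟩
    Fréchet w x z            ∎
    where
    open ℚ.≤-Reasoning
    open Realises r
    dtw²≤costs : ∀ i → dtw² (_ , series) (x i) ℚ.≤ costs i
    dtw²≤costs i = dtw²-≤ (subst (λ m → Walk y zs m (costs i)) (Vec.lookup∘tabulate l i) (walks i))
      where open PathsAndWalks series (proj₂ (x i))
    dtw²-walks : Walks (q ∷ toList qs) (fullState l) (λ i → dtw² z (x i))
    dtw²-walks i = subst (λ m → Walk y zs m (dtw² z (x i))) (sym (Vec.lookup∘tabulate l i)) dtw²-walk
      where open PathsAndWalks (q ∷ qs) (proj₂ (x i))

  box-total : ∀ {n} → 1 ≤ k → 1 ≤ n → (∀ i → l i < n) →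
    length (box (fullState l)) * perState n + k * n ≤ 84 * (n ^ (2 * k + 1) * 2 ^ k * k)
  box-total {n} 1≤k 1≤n l<n = total-≤ k n _ 1≤k 1≤n (length-box {fullState l} (fullState-< l<n))

  meanProgram-outcome : ∀ {n} → 1 ≤ k → (∀ i → l i < n) →
    Outcome (λ s → ∀ z → Fréchet w x s ℚ.≤ Fréchet w x z) (meanProgram l) emptyTable
      (length (box (fullState l)) * perState n + k * n)
  meanProgram-outcome {n} 1≤k l<n = fillTable-outcome {L} L<n _ (box (fullState l)) _
    (box-ascending L) (All.tabulate (∈-box⁻ L)) (λ v v≤L → inj₁ (∈-box⁺ L v v≤L))
    λ memo opt → let o@(_ , r , _) = opt (fullState l) (λ _ → ℕ.≤-refl) in
      -- The output has at most 1 + Σ `l i` elements, and 1 ≤ k raises this to the total input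
      -- length.
      Fréchet-minimal o , ℕ.≤-trans (s≤s (Realises.short r))
        (ℕ.≤-trans (ℕ.+-monoˡ-≤ _ 1≤k) (sum-tabulate l l<n))
    where
    L : State
    L = fullState l
    L<n : ∀ i → lookup L i < n
    L<n = fullState-< l<n

theorem2 : ∃ λ (A : Algorithm) → ∃ λ (C : ℕ) →
    ∀ (k : ℕ) .{{_ : NonZero k}} (x : Fin k → 𝒯) (w : Fin k → ℚ.ℚ) →
    (∀ i → ℚ.0ℚ ℚ.≤ w i) →
    let n = maxLength x in
    (∀ (z : 𝒯) → Fréchet w x (solution A w x) ℚ.≤ Fréchet w x z) ×
    runningTime A w x ≤ C * (n ^ (2 * k + 1) * 2 ^ k * k)
theorem2 = meanProgram , 84 , λ { k@(suc _) x w 0≤w →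
  let open Machine.Outcome (meanProgram-outcome x w 0≤w (s≤s z≤n) (len≤maxLength x))
  in holds , ℕ.≤-trans bounded (box-total x w 0≤w (s≤s z≤n)
       (ℕ.≤-trans (s≤s z≤n) (len≤maxLength x zero)) (len≤maxLength x)) }
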